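{- Let $f(x_1,\ldots,x_n)$ and $h(x_1,\ldots,x_n)$ be arbitrary Boolean functions of $n$ variables represented in conjunctive normal form with $m$ clauses, such that there are assignment tuples $(\sigma_1,\ldots,\sigma_n)$ and $(\delta_1,\ldots,\delta_n)$ in $\{0,1\}^n$ with $f(\sigma_1,\ldots,\sigma_n)=1$ and $h(\delta_1,\ldots,\delta_n)=1$. Then the function $f(x_1,\ldots,x_n)$ generates the function $h(x_1,\ldots,x_n)$ as a result of extended admissible changes in no more than $c\times(n\times m)$ elementary operations, for some constant $c$.
   Context: CNF conventions. A Boolean function $f(x_1,\ldots,x_n)$ in conjunctive normal form (CNF) with $m$ clauses is given as $f=\bigwedge_{i=1}^m c_i$, each clause being $c_i=x_{j_1}^{\alpha_1}\vee\cdots\vee x_{j_k}^{\alpha_k}$ with $k\in\{1,\ldots,n\}$, $\{j_1,\ldots,j_k\}\subseteq\{1,\ldots,n\}$, $\alpha_r\in\{0,1\}$, $x_j^0=\bar x_j$, $x_j^1=x_j$. Standing assumptions: no clause contains both a variable and its negation; every variable $x_j$, $j\in\{1,\ldots,n\}$, occurs (negated or not) in some clause. Clauses are numbered and identified with their numbers, so $S(f)=\{c_1,\ldots,c_m\}$ is an ordered set of $m$ elements. Special decomposition and covering. For a nonempty ordered set $S=\{e_1,\ldots,e_m\}$, an ordered set $d_nS=\{(M_1^0,M_1^1),\ldots,(M_n^0,M_n^1)\}$ of ordered pairs of subsets of $S$ is a special decomposition of $S$ if for all $i$, $M_i^0\cap M_i^1=\emptyset$ and ($M_i^0\ne\emptyset$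 or $M_i^1\neq\emptyset$), and $\bigcup_{i}(M_i^0\cup M_i^1)=S$. The ordered set $c_nS=\{M_1^{\alpha_1},\ldots,M_n^{\alpha_n}\}$ is a special covering for $S$ under $d_nS$ if $\bigcup_i M_i^{\alpha_i}=S$. Decomposition generated by $f$. $d_nS(f)=\{(F_1^0,F_1^1),\ldots,(F_n^0,F_n^1)\}$, where $F_i^\alpha$ is the set of clauses $c_j\in S(f)$ containing the literal $x_i^\alpha$. When $f(\sigma_1,\ldots,\sigma_n)=1$, $\{F_1^{\sigma_1},\ldots,F_n^{\sigma_n}\}$ is the associated special covering $c_nS(f)$. Function generated by a special decomposition $d_nS$. $h=\bigwedge_{i=1}^m c_i'$, where $c_i'$ is the disjunction of the literals in $\{x_j^\alpha: e_i\in M_j^\alpha,\ j\in\{1,\ldots,n\},\ \alpha\in\{0,1\}\}$ (the first component of the $j$-th pair playing the role of $M_j^0$, the second that of $M_j^1$). Admissible changes under a tuple $(\alpha_1,\ldots,\alpha_n)$. Let $c_nS=\{M_1^{\alpha_1},\ldots,M_n^{\alpha_n}\}$ be a special covering under $d_nS$. Write $\bar\delta=1-\delta$; membership of $M_i^\delta$ in $c_nS$ means $\delta=\alpha_i$. The following changes are admissible: (i.1) for $e\in M_i^\delta$, replace $M_i^\delta$ by $M_i^\delta\setminus\{e\}$, if $M_i^\delta\notin c_nS$ and $(M_i^\delta\setminus\{e\})\cup M_i^{\bar\delta}\neq\emptyset$; (i.2) for $e\in S$ with $e\notin M_i^0\cup M_i^1$, replace $M_i^\delta$ by $M_i^\delta\cup\{e\}$;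 (i.3) if $M_j^\gamma$ and $M_i^\delta$ are both in $c_nS$, then for $e$ with $e\in M_j^\gamma$ and $e\notin M_i^{\bar\delta}$, replace $M_j^\gamma$ by $M_j^\gamma\setminus\{e\}$ and $M_i^\delta$ by $M_i^\delta\cup\{e\}$. Changes are applied successively, each to the current pairs and with the current covering sets having the current tuple of superscripts. Extended admissible changes. To the admissible changes one adds the operation of permuting the components of an ordered pair, i.e. replacing $(M_i^0,M_i^1)$ by $(M_i^1,M_i^0)$ (the former $M_i^1$ becomes the first component, the former $M_i^0$ the second). If admissible changes are being performed under a tuple of superscripts $(\sigma_1,\ldots,\sigma_n)$ and the components of the $i$-th pair are permuted, then admissible changes continue under the tuple $(\sigma_1,\ldots,1-\sigma_i,\ldots,\sigma_n)$. The starting tuple is that of a special covering under the starting decomposition. Generation by extended admissible changes. For $f$ such that $f(\sigma_1,\ldots,\sigma_n)=1$ for some assignment tuple, $f$ generates $h$ as a result of extended admissible changes if a special decomposition is generated as a result of extended admissible changes in $d_nS(f)$ and $h$ is the function generated by that special decomposition. Representation. A function $f$ in CNF is represented by the $(m\times n)$-matrix $(f)\mathrm{cnf}$ with entry $(i,j)$ equal to $-1$ if $\bar x_j$ is in $c_i$, $1$ if $x_j$ is in $c_i$, $0$ otherwise. A special decomposition is represented by the pair of $(n\times m)$ $(0,1)$-matrices $(sM0,sM1)$ with $sM\alpha(i,j)=1$ if $e_j\in M_i^\alpha$ and $0$ otherwise. Elementary operations: assigning a value to a function variable or to an array element; addition and subtraction of numbers; comparison of two numbers; recognition of a literal. "Constant"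 means independent of $n$, $m$ and the functions. -}

module Defs where

open import Data.Bool.Base using (Bool; true; false; not; _∧_; _∨_; if_then_else_)
open import Data.Bool.ListAction using (all; any)
open import Data.Fin.Base using (Fin; toℕ)
open import Data.Fin.Subset using (Subset; _∈_; _∉_; _∪_; _∩_; _-_; ⁅_⁆; ⋃; ⊤; Nonempty; Empty)
open import Data.Integer.Base as ℤ using (ℤ; +_; -1ℤ; 0ℤ; 1ℤ)
import Data.Integer.Properties as ℤ
open import Data.List.Base using (List; []; _∷_; map; allFin)
import Data.List.Membership.Propositional as List
open import Data.List.Relation.Unary.All as All using (All; []; _∷_)
open import Data.Nat.Base using (ℕ; _+_; _*_; _≤_)
import Data.Nat.Properties as ℕ
open import Data.Product.Base using (_×_; _,_; proj₁; proj₂; ∃; ∃-syntax)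
open import Data.Sum.Base using (_⊎_)
open import Data.Unit.Base as Unit using ()
open import Data.Vec.Base as Vec using (Vec; lookup; tabulate; updateAt)
open import Relation.Binary.Construct.Closure.ReflexiveTransitive using (Star)
open import Relation.Binary.PropositionalEquality.Core using (_≡_; _≢_)
open import Relation.Nullary.Decidable.Core using (⌊_⌋)
import Data.Product.Base as Product

private
  variable
    n m : ℕ

-- A pair (A⁰ , A¹) is indexed by superscripts: false is 0 and true is 1.
infixl 8 _^_
_^_ : {A : Set} → A × A → Bool → A
(a⁰ , a¹) ^ false = a⁰
(a⁰ , a¹) ^ true  = a¹

updateComponent : {A : Set} → Bool → (A → A) → A × A → A × A
updateComponent false g (a⁰ , a¹) = g a⁰ , a¹
updateComponent true  g (a⁰ , a¹) = a⁰ , g a¹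

-- A clause c is given by its literals: x_j^α occurs in c when j ∈ c ^ α.
Clause : ℕ → Set
Clause n = Subset n × Subset n

record CNF (n m : ℕ) : Set where
  field
    clauses    : Vec (Clause n) m
    nonempty   : ∀ i → ∃[ j ] ∃[ α ] j ∈ lookup clauses i ^ α
    consistent : ∀ i → Empty (lookup clauses i ^ false ∩ lookup clauses i ^ true)
    occurs     : ∀ j → ∃[ i ] ∃[ α ] j ∈ lookup clauses i ^ α

open CNF public

literalValue : Bool → Bool → Bool
literalValue false x = not x
literalValue true  x = x

clauseValue : Clause n → Vec Bool n → Bool
clauseValue {n} c σ = any (λ j → any (literal j) (false ∷ true ∷ [])) (allFin n)
  where
  literal : Fin n → Bool → Bool
  literal j α = lookup (c ^ α) j ∧ literalValue α (lookup σ j)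

value : CNF n m → Vec Bool n → Bool
value {m = m} f σ = all (λ i → clauseValue (lookup (clauses f) i) σ) (allFin m)

cnfMatrix : CNF n m → Vec (Vec ℤ n) m
cnfMatrix f = Vec.map row (clauses f)
  where
  row : Clause _ → Vec ℤ _
  row c = tabulate λ j → if lookup (c ^ false) j then -1ℤ
                         else if lookup (c ^ true) j then 1ℤ else 0ℤ

-- Special decompositions are of S = {e₁,…,eₘ}, whose elements are identified
-- with their positions in Fin m.  Since Subset m is Vec Bool m, the two
-- components of the i-th pair are literally the i-th rows of sM0 and sM1.
Decomposition : ℕ → ℕ → Set
Decomposition n m = Vec (Subset m × Subset m) n

record IsSpecialDecomposition (D : Decomposition n m) : Set where
  field
    disjoint : ∀ i → Empty (lookup D i ^ false ∩ lookup D i ^ true)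
    inhabited : ∀ i → Nonempty (lookup D i ^ false) ⊎ Nonempty (lookup D i ^ true)
    exhaustive : ⋃ (map (λ i → lookup D i ^ false ∪ lookup D i ^ true) (allFin n)) ≡ ⊤

IsSpecialCovering : Decomposition n m → Vec Bool n → Set
IsSpecialCovering {n} D α = ⋃ (map (λ i → lookup D i ^ lookup α i) (allFin n)) ≡ ⊤

decomposition : CNF n m → Decomposition n m
decomposition f = tabulate λ j → F j false , F j true
  where
  F : Fin _ → Bool → Subset _
  F j α = tabulate λ i → lookup (lookup (clauses f) i ^ α) j

generatedClauses : Decomposition n m → Vec (Clause n) m
generatedClauses D = tabulate λ i → literals i false , literals i true
  where
  literals : Fin _ → Bool → Subset _
  literals i α = tabulate λ j → lookup (lookup D j ^ α) i

-- V and C are the types of references to pairs and to elements of S.  They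
-- are Fin n and Fin m for actual changes; programs use loop variables instead.
data Change (V C : Set) : Set where
  delete  : (i : V) (δ : Bool) (e : C) → Change V C
  insert  : (i : V) (δ : Bool) (e : C) → Change V C
  move    : (j : V) (γ : Bool) (i : V) (δ : Bool) (e : C) → Change V C
  permute : (i : V) → Change V C

-- The current pairs together with the current tuple of superscripts.
Configuration : ℕ → ℕ → Set
Configuration n m = Decomposition n m × Vec Bool n

-- Moving an element from a covering set to itself is left out (j ≢ i): it would
-- change nothing.
Admissible : Change (Fin n) (Fin m) → Configuration n m → Set
Admissible (delete i δ e) (D , τ) =
  e ∈ lookup D i ^ δ ×
  δ ≢ lookup τ i ×
  Nonempty ((lookup D i ^ δ - e) ∪ lookup D i ^ not δ)
Admissible (insert i δ e) (D , τ) =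
  e ∉ lookup D i ^ false ∪ lookup D i ^ true
Admissible (move j γ i δ e) (D , τ) =
  j ≢ i ×
  γ ≡ lookup τ j ×
  δ ≡ lookup τ i ×
  e ∈ lookup D j ^ γ ×
  e ∉ lookup D i ^ not δ
Admissible (permute i) (D , τ) = Unit.⊤

apply : Change (Fin n) (Fin m) → Configuration n m → Configuration n m
apply (delete i δ e)   (D , τ) = updateAt D i (updateComponent δ (_- e)) , τ
apply (insert i δ e)   (D , τ) = updateAt D i (updateComponent δ (_∪ ⁅ e ⁆)) , τ
apply (move j γ i δ e) (D , τ) =
  updateAt (updateAt D j (updateComponent γ (_- e)))
           i (updateComponent δ (_∪ ⁅ e ⁆)) , τ
apply (permute i)      (D , τ) = updateAt D i Product.swap , updateAt τ i not

data _⟶_ (s : Configuration n m) : Configuration n m → Set where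
  change : ∀ ch → Admissible ch s → s ⟶ apply ch s

_⟶*_ : Configuration n m → Configuration n m → Set
_⟶*_ = Star _⟶_

-- A program is a finite piece of syntax that mentions neither n, m nor any
-- particular function.  Its loop variables range over the variables or the
-- clauses of the functions at hand; registers hold arbitrary integers.

data Sort : Set where
  var clause : Sort

Context : Set
Context = List Sort

Index : Sort → Context → Set
Index s Γ = s List.∈ Γ

-- build     reads (f)cnf and σ, and writes sM0, sM1 and the current tuple;
-- transform reads (h)cnf and δ, and alters sM0, sM1 and the current tuple
--           through extended admissible changes only;
-- readout   reads sM0 and sM1, and writes the resulting CNF matrix.
data Phase : Set where
  build transform readout : Phase

private
  variable
    p : Phase
    s : Sort
    Γ : Context

data Expr : Phase → Context → Set where
  const   : ℤ → Expr p Γ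
  reg     : ℕ → Expr p Γ
  index   : Index s Γ → Expr p Γ
  sM      : Bool → Index var Γ → Index clause Γ → Expr p Γ
  current : Index var Γ → Expr p Γ
  fcnf    : Index clause Γ → Index var Γ → Expr build Γ
  σ[_]    : Index var Γ → Expr build Γ
  hcnf    : Index clause Γ → Index var Γ → Expr transform Γ
  δ[_]    : Index var Γ → Expr transform Γ
  _⊕_ _⊖_ : Expr p Γ → Expr p Γ → Expr p Γ

-- With functions given as matrices, recognising a literal x_j^α in c_i is
-- the comparison of the entry (i,j) with 1 or -1.
data Test : Phase → Context → Set where
  _==_ _<_ : Expr p Γ → Expr p Γ → Test p Γ

infixr 5 _⨾_
infix 6 test_then_else_
infix 7 _==_ _<_
infixl 8 _⊕_ _⊖_

data Program : Phase → Context → Set where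
  skip            : Program p Γ
  _⨾_             : Program p Γ → Program p Γ → Program p Γ
  setReg          : ℕ → Expr p Γ → Program p Γ
  test_then_else_ : Test p Γ → Program p Γ → Program p Γ → Program p Γ
  for             : (s : Sort) → Program p (s ∷ Γ) → Program p Γ
  setM            : Bool → Index var Γ → Index clause Γ → Bool → Program build Γ
  setCurrent      : Index var Γ → Bool → Program build Γ
  perform         : Change (Index var Γ) (Index clause Γ) → Program transform Γ
  setOut          : Index clause Γ → Index var Γ → Expr readout Γ → Program readout Γ

record Memory (n m : ℕ) : Set where
  field
    registers : ℕ → ℤ
    sMatrices : Decomposition n m
    tuple     : Vec Bool n
    output    : Vec (Vec ℤ n) m

  configuration : Configuration n m
  configuration = sMatrices , tuple

open Memory public

exprCost : Expr p Γ → ℕ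
exprCost (a ⊕ b) = exprCost a + exprCost b + 1
exprCost (a ⊖ b) = exprCost a + exprCost b + 1
exprCost _       = 0

testCost : Test p Γ → ℕ
testCost (a == b) = exprCost a + exprCost b + 1
testCost (a < b)  = exprCost a + exprCost b + 1

-- The number of elementary operations realising a change on sM0, sM1 and the
-- current tuple.  Permuting a pair swaps two rows of length m by three
-- assignments per column inside a loop, which costs 3 per iteration and 2
-- more overall, and then replaces the superscript τᵢ by 1 - τᵢ.
changeCost : {V C : Set} → ℕ → Change V C → ℕ
changeCost m (delete _ _ _)   = 1
changeCost m (insert _ _ _)   = 1
changeCost m (move _ _ _ _ _) = 2
changeCost m (permute _)      = m * (3 + 3) + 2 + 2

module Execution {n m : ℕ} (f h : CNF n m) (σ δ : Vec Bool n) where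

  size : Sort → ℕ
  size var    = n
  size clause = m

  Environment : Context → Set
  Environment Γ = All (λ s → Fin (size s)) Γ

  private
    variable
      ρ : Environment Γ
      M M′ M″ : Memory n m
      k l : ℕ

  bit : Bool → ℤ
  bit b = if b then 1ℤ else 0ℤ

  ⟦_⟧ : Expr p Γ → Environment Γ → Memory n m → ℤ
  ⟦ const z ⟧   ρ M = z
  ⟦ reg r ⟧     ρ M = registers M r
  ⟦ index x ⟧   ρ M = + toℕ (All.lookup ρ x)
  ⟦ sM α j i ⟧  ρ M = bit (lookup (lookup (sMatrices M) (All.lookup ρ j) ^ α) (All.lookup ρ i))
  ⟦ current j ⟧ ρ M = bit (lookup (tuple M) (All.lookup ρ j))
  ⟦ fcnf i j ⟧  ρ M = lookup (lookup (cnfMatrix f) (All.lookup ρ i)) (All.lookup ρ j)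
  ⟦ σ[ j ] ⟧    ρ M = bit (lookup σ (All.lookup ρ j))
  ⟦ hcnf i j ⟧  ρ M = lookup (lookup (cnfMatrix h) (All.lookup ρ i)) (All.lookup ρ j)
  ⟦ δ[ j ] ⟧    ρ M = bit (lookup δ (All.lookup ρ j))
  ⟦ a ⊕ b ⟧     ρ M = ⟦ a ⟧ ρ M ℤ.+ ⟦ b ⟧ ρ M
  ⟦ a ⊖ b ⟧     ρ M = ⟦ a ⟧ ρ M ℤ.- ⟦ b ⟧ ρ M

  holds : Test p Γ → Environment Γ → Memory n m → Bool
  holds (a == b) ρ M = ⌊ ⟦ a ⟧ ρ M ℤ.≟ ⟦ b ⟧ ρ M ⌋
  holds (a < b)  ρ M = ⌊ ⟦ a ⟧ ρ M ℤ.<? ⟦ b ⟧ ρ M ⌋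

  resolve : Environment Γ → Change (Index var Γ) (Index clause Γ) → Change (Fin n) (Fin m)
  resolve ρ (delete i α e)   = delete (All.lookup ρ i) α (All.lookup ρ e)
  resolve ρ (insert i α e)   = insert (All.lookup ρ i) α (All.lookup ρ e)
  resolve ρ (move j γ i α e) = move (All.lookup ρ j) γ (All.lookup ρ i) α (All.lookup ρ e)
  resolve ρ (permute i)      = permute (All.lookup ρ i)

  storeRegister : ℕ → ℤ → Memory n m → Memory n m
  storeRegister r z M = record M
    { registers = λ r′ → if ⌊ r′ ℕ.≟ r ⌋ then z else registers M r′ }

  storeMatrix : Bool → Fin n → Fin m → Bool → Memory n m → Memory n m
  storeMatrix α j i b M = record M
    { sMatrices = updateAt (sMatrices M) j (updateComponent α (λ R → R Vec.[ i ]≔ b)) }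

  storeCurrent : Fin n → Bool → Memory n m → Memory n m
  storeCurrent j b M = record M { tuple = tuple M Vec.[ j ]≔ b }

  storeOutput : Fin m → Fin n → ℤ → Memory n m → Memory n m
  storeOutput i j z M = record M { output = updateAt (output M) i (λ R → R Vec.[ j ]≔ z) }

  applyChange : Change (Fin n) (Fin m) → Memory n m → Memory n m
  applyChange ch M = record M
    { sMatrices = proj₁ (apply ch (configuration M))
    ; tuple     = proj₂ (apply ch (configuration M))
    }

  mutual
    -- Run ρ c M M′ k: started in memory M, the program c halts in memory M′
    -- after k elementary operations.  A change that is not admissible has no
    -- execution.
    data Run : ∀ {p Γ} → Environment Γ → Program p Γ → Memory n m → Memory n m → ℕ → Set where
      skip     : Run {p} ρ skip M M 0
      seq      : {c d : Program p Γ} → Run ρ c M M′ k → Run ρ d M′ M″ l → Run ρ (c ⨾ d) M M″ (k + l)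
      assign   : ∀ {r} {a : Expr p Γ} →
                 Run ρ (setReg r a) M (storeRegister r (⟦ a ⟧ ρ M) M) (exprCost a + 1)
      if-true  : ∀ {t} {c d : Program p Γ} → holds t ρ M ≡ true → Run ρ c M M′ k →
                 Run ρ (test t then c else d) M M′ (testCost t + k)
      if-false : ∀ {t} {c d : Program p Γ} → holds t ρ M ≡ false → Run ρ d M M′ k →
                 Run ρ (test t then c else d) M M′ (testCost t + k)
      for      : {c : Program p (s ∷ Γ)} → RunEach ρ c (allFin (size s)) M M′ k →
                 Run ρ (for s c) M M′ (1 + k)
      assignM  : ∀ {α j i b} →
                 Run ρ (setM α j i b) M
                       (storeMatrix α (All.lookup ρ j) (All.lookup ρ i) b M) 1
      assignτ  : ∀ {j b} →
                 Run ρ (setCurrent j b) M (storeCurrent (All.lookup ρ j) b M) 1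
      perform  : ∀ {ch} → Admissible (resolve ρ ch) (configuration M) →
                 Run ρ (perform ch) M (applyChange (resolve ρ ch) M) (changeCost m ch)
      assignO  : ∀ {i j a} →
                 Run ρ (setOut i j a) M
                       (storeOutput (All.lookup ρ i) (All.lookup ρ j) (⟦ a ⟧ ρ M) M)
                       (exprCost a + 1)

    -- Besides the initial assignment to the loop variable charged above, each
    -- test for the end of the loop is one comparison, and each iteration
    -- increments the loop variable by one addition and one assignment.
    data RunEach {p Γ s} (ρ : Environment Γ) (c : Program p (s ∷ Γ)) :
                 List (Fin (size s)) → Memory n m → Memory n m → ℕ → Set where
      []  : RunEach ρ c [] M M 1
      _∷_ : ∀ {x xs} → Run (x ∷ ρ) c M M′ k → RunEach ρ c xs M′ M″ l →
            RunEach ρ c (x ∷ xs) M M″ (1 + k + 2 + l)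

record Procedure : Set where
  field
    building     : Program build []
    transforming : Program transform []
    readingOut   : Program readout []

open Procedure public

-- The initial contents M₀ of the writable memory are arbitrary, so building sM0
-- and sM1 from (f)cnf is part of the count, as is reading (h)cnf off the result.
record GeneratesWithin (P : Procedure) (f h : CNF n m) (σ δ : Vec Bool n)
                       (M₀ : Memory n m) (bound : ℕ) : Set where
  open Execution f h σ δ
  field
    {M₁ M₂ M₃}      : Memory n m
    {k₁ k₂ k₃}      : ℕ

    runBuilding     : Run [] (building P) M₀ M₁ k₁
    start           : configuration M₁ ≡ (decomposition f , σ)
    startCovering   : IsSpecialCovering (decomposition f) σ

    runTransforming : Run [] (transforming P) M₁ M₂ k₂
    changes         : (decomposition f , σ) ⟶* configuration M₂
    isDecomposition : IsSpecialDecomposition (sMatrices M₂)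
    generated       : generatedClauses (sMatrices M₂) ≡ clauses h

    runReadingOut   : Run [] (readingOut P) M₂ M₃ k₃
    result          : output M₃ ≡ cnfMatrix h

    withinBound     : k₁ + k₂ + k₃ ≤ bound

{-# OPTIONS --safe #-}
module Submission where

-- View a decomposition as a table with a cell for each variable and each
-- clause; a cell holds a literal or is empty.  With at least two clauses:
-- permute pairs until the tuple of superscripts is δ, fill every empty cell
-- with its covering literal, and then delete every other literal and insert the
-- covering one instead, which is admissible since full rows stay inhabited.
-- Now every cell is covering.  As h(δ) = 1, each clause of h contains a covering
-- literal, of x_i say; in its column every covering literal that is not in h
-- moves into the i-th pair, where it is absorbed, and the literal of h is
-- inserted in its place.  With a single clause every cell of f and h is
-- occupied, and permuting pairs suffices (deletions would not be admissible).

open import Defs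
open import Data.Bool.Base using (Bool; true; false; not; T; _∧_; _∨_; if_then_else_)
import Data.Bool.Properties as Bool
open import Data.Fin.Base using (Fin; zero; suc; toℕ; fromℕ<)
import Data.Fin.Properties as Fin
open import Data.Fin.Subset using (Subset; _∈_; _∉_; _∪_; _-_; ⁅_⁆; ⋃; ⊤; Nonempty)
open import Data.Fin.Subset.Properties
  using (⊆-antisym; ∈⊤; x∈p∪q⁺; x∈p∪q⁻; x∈p∩q⁺; x∈p∩q⁻; ∪-identityʳ; p─⊥≡p; x∈p∧x≢y⇒x∈p-y)
open import Data.Integer.Base as ℤ using (ℤ; 0ℤ; 1ℤ; -1ℤ)
import Data.Integer.Properties as ℤ
open import Data.List.Base using (List; []; _∷_; map; allFin; length)
import Data.List.Membership.Propositional as List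
open import Data.List.Membership.Propositional.Properties using (∈-allFin)
import Data.List.Properties as List
open import Data.List.Relation.Unary.All as All using ([]; _∷_)
open import Data.List.Relation.Unary.All.Properties using (all⁺)
open import Data.List.Relation.Unary.Any as Any using (here; there)
open import Data.List.Relation.Unary.Any.Properties using (any⁻)
open import Data.Maybe.Base as Maybe using (Maybe; just; nothing)
open import Data.Nat.Base using (ℕ; zero; suc; _+_; _*_; _≤_; z≤n; NonZero; ≢-nonZero⁻¹; >-nonZero⁻¹)
import Data.Nat.Properties as ℕ
open import Data.Nat.Solver using (module +-*-Solver)
open import Data.Product.Base using (_×_; _,_; proj₁; proj₂; ∃-syntax; Σ-syntax; swap)
open import Data.Sum.Base using (_⊎_; inj₁; inj₂)
open import Data.Unit.Base using (tt) renaming (⊤ to ⊤′)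
open import Data.Vec.Base using (Vec; _∷_; lookup; tabulate; updateAt; _[_]≔_)
open import Data.Vec.Properties
  using ( lookup∘tabulate; tabulate∘lookup; tabulate-cong; lookup-map; lookup⇒[]=; []=⇒lookup
        ; lookup∘updateAt; lookup∘updateAt′; lookup∘update; lookup∘update′)
open import Function.Base using (id; _∘_)
open import Function.Bundles using (Equivalence)
open import Relation.Binary.Construct.Closure.ReflexiveTransitive using (ε; _◅_; _◅◅_)
open import Relation.Binary.PropositionalEquality
  using (_≡_; _≢_; refl; sym; trans; cong; cong₂; subst)
open import Relation.Nullary.Decidable using (yes; no; ⌊_⌋; toWitness; _×-dec_)
open import Relation.Nullary.Negation using (¬_; contradiction)

-- A covering literal can never be deleted, since rule (i.1) excludes the sets of the covering. It
-- can leave its cell only by a move into another covering set, and it vanishes there because that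
-- set already has the element. With every cell covering, any other pair may receive; the one chosen
-- has a covering literal that stays in `h`, so its cell is the same before and after it is settled.
-- A move carries no nonemptiness condition, so a pair may be empty for a moment. That the result is
-- a special decomposition is therefore deduced only at the end, from its equality with
-- `decomposition h`.
--
-- Two steps endanger the linear bound. A permutation costs a whole row, so each pair is permuted at
-- most once. Settling a clause is a pass over all pairs inside a search over all pairs; the search
-- sets a flag at its first success, and an amortised loop rule charges the pass once per clause,
-- not once per pair.

private
  variable
    n m : ℕ
    A : Set

-- Vectors and subsets as bit arrays

lookup-extensional : {xs ys : Vec A n} → (∀ i → lookup xs i ≡ lookup ys i) → xs ≡ ys
lookup-extensional {xs = xs} {ys} eq =
  trans (sym (tabulate∘lookup xs)) (trans (tabulate-cong eq) (tabulate∘lookup ys))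

-- Deletion and insertion become assignments of one bit. This is also the form of the writes in the
-- building phase, so `updateAt-updated` treats all of them at once.
p-x≡p[x]≔false : (p : Subset n) (x : Fin n) → p - x ≡ p [ x ]≔ false
p-x≡p[x]≔false (_ ∷ p) zero    = cong (false ∷_) (p─⊥≡p p)
p-x≡p[x]≔false (b ∷ p) (suc x) = cong (b ∷_) (p-x≡p[x]≔false p x)

p∪⁅x⁆≡p[x]≔true : (p : Subset n) (x : Fin n) → p ∪ ⁅ x ⁆ ≡ p [ x ]≔ true
p∪⁅x⁆≡p[x]≔true (b ∷ p) zero    = cong₂ _∷_ (Bool.∨-zeroʳ b) (∪-identityʳ p)
p∪⁅x⁆≡p[x]≔true (b ∷ p) (suc x) = cong₂ _∷_ (Bool.∨-identityʳ b) (p∪⁅x⁆≡p[x]≔true p x)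

⋃-allFin≡⊤ : (p : Fin n → Subset m) → (∀ x → ∃[ i ] x ∈ p i) → ⋃ (map p (allFin n)) ≡ ⊤
⋃-allFin≡⊤ {n} p covers = ⊆-antisym (λ _ → ∈⊤) (λ {x} _ → ∈-⋃ x (∈-allFin (proj₁ (covers x))))
  where
  ∈-⋃ : ∀ x {is : List (Fin n)} → proj₁ (covers x) List.∈ is → x ∈ ⋃ (map p is)
  ∈-⋃ x (here refl) = x∈p∪q⁺ (inj₁ (proj₂ (covers x)))
  ∈-⋃ x (there i∈)  = x∈p∪q⁺ (inj₂ (∈-⋃ x i∈))

-- Decompositions and formulas as tables of cells

cell : Decomposition n m → Fin n → Fin m → Bool × Bool
cell D j e = lookup (lookup D j ^ false) e , lookup (lookup D j ^ true) e

-- The pair `true , true` is not in the image, so an equation `cell D j e ≡ toCell o` also records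
-- disjointness at this cell.
toCell : Maybe Bool → Bool × Bool
toCell nothing      = false , false
toCell (just false) = true , false
toCell (just true)  = false , true

toℤ : Maybe Bool → ℤ
toℤ nothing      = 0ℤ
toℤ (just false) = -1ℤ
toℤ (just true)  = 1ℤ

lookup-cell : ∀ (D : Decomposition n m) j e α → lookup (lookup D j ^ α) e ≡ cell D j e ^ α
lookup-cell D j e false = refl
lookup-cell D j e true  = refl

toCell-^ : ∀ o α → toCell o ^ α ≡ true → o ≡ just α
toCell-^ (just false) false _ = refl
toCell-^ (just true)  true  _ = refl
toCell-^ nothing      false ()
toCell-^ nothing      true  ()
toCell-^ (just true)  false ()
toCell-^ (just false) true  ()

toCell-just-^ : ∀ α → toCell (just α) ^ α ≡ true
toCell-just-^ false = refl
toCell-just-^ true  = refl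

swap-toCell : ∀ o → swap (toCell o) ≡ toCell (Maybe.map not o)
swap-toCell nothing      = refl
swap-toCell (just false) = refl
swap-toCell (just true)  = refl

module _ {D : Decomposition n m} {j : Fin n} {e : Fin m} where

  ∈-cell⁺ : ∀ α → cell D j e ≡ toCell (just α) → e ∈ lookup D j ^ α
  ∈-cell⁺ false eq = lookup⇒[]= e _ (cong proj₁ eq)
  ∈-cell⁺ true  eq = lookup⇒[]= e _ (cong proj₂ eq)

  ∈-cell⁻ : ∀ o α → cell D j e ≡ toCell o → e ∈ lookup D j ^ α → o ≡ just α
  ∈-cell⁻ o α eq e∈ =
    toCell-^ o α (trans (sym (cong (_^ α) eq)) (trans (sym (lookup-cell D j e α)) ([]=⇒lookup e∈)))

∈-^-∪ : ∀ {p : Subset m × Subset m} {x} α → x ∈ p ^ α → x ∈ p ^ false ∪ p ^ true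
∈-^-∪ false = x∈p∪q⁺ ∘ inj₁
∈-^-∪ true  = x∈p∪q⁺ ∘ inj₂

decomposition-extensional : {D E : Decomposition n m} →
  (∀ j e → cell D j e ≡ cell E j e) → D ≡ E
decomposition-extensional eq = lookup-extensional λ j → cong₂ _,_
  (lookup-extensional (cong proj₁ ∘ eq j)) (lookup-extensional (cong proj₂ ∘ eq j))

-- The superscripts are tested in the order used by `cnfMatrix`. Consistency of clauses enters in
-- `clause-cell`, where it excludes that both literals are present.
occurrence : CNF n m → Fin n → Fin m → Maybe Bool
occurrence f j e =
  if lookup (lookup (clauses f) e ^ false) j then just false else
  if lookup (lookup (clauses f) e ^ true) j then just true else nothing

-- The hypothesis is what `any` over `false ∷ true ∷ []` in `clauseValue` unfolds to at one
-- variable: `c` tells which of its two literals occur, and `x` is its value.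
true-literal : ∀ (c : Bool × Bool) x → T ((proj₁ c ∧ not x) ∨ (proj₂ c ∧ x ∨ false)) → c ^ x ≡ true
true-literal (true  , _)     false _ = refl
true-literal (false , false) false ()
true-literal (false , true)  false ()
true-literal (_     , true)  true  _ = refl
true-literal (false , false) true  ()
true-literal (true  , false) true  ()

module _ (f : CNF n m) where

  lookup-cnfMatrix : ∀ j e → lookup (lookup (cnfMatrix f) e) j ≡ toℤ (occurrence f j e)
  lookup-cnfMatrix j e = trans (cong (λ r → lookup r j) (lookup-map e _ (clauses f)))
    (trans (lookup∘tabulate _ j) entry)
    where
    entry : (if lookup (lookup (clauses f) e ^ false) j then -1ℤ else
             if lookup (lookup (clauses f) e ^ true) j then 1ℤ else 0ℤ) ≡ toℤ (occurrence f j e)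
    entry with lookup (lookup (clauses f) e ^ false) j | lookup (lookup (clauses f) e ^ true) j
    ... | true  | _     = refl
    ... | false | true  = refl
    ... | false | false = refl

  clause-cell : ∀ j e → (lookup (lookup (clauses f) e ^ false) j , lookup (lookup (clauses f) e ^ true) j)
                        ≡ toCell (occurrence f j e)
  clause-cell j e
    with lookup (lookup (clauses f) e ^ false) j in eq⁰ | lookup (lookup (clauses f) e ^ true) j in eq¹
  ... | true  | true  = contradiction (j , x∈p∩q⁺ (lookup⇒[]= j _ eq⁰ , lookup⇒[]= j _ eq¹)) (consistent f e)
  ... | true  | false = refl
  ... | false | true  = refl
  ... | false | false = refl

  ∈-clause⁻ : ∀ {j e} α → j ∈ lookup (clauses f) e ^ α → occurrence f j e ≡ just α
  ∈-clause⁻ {j} {e} false j∈ = toCell-^ _ false (trans (sym (cong proj₁ (clause-cell j e))) ([]=⇒lookup j∈))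
  ∈-clause⁻ {j} {e} true  j∈ = toCell-^ _ true (trans (sym (cong proj₂ (clause-cell j e))) ([]=⇒lookup j∈))

  cell-decomposition : ∀ j e → cell (decomposition f) j e ≡ toCell (occurrence f j e)
  cell-decomposition j e = trans
    (cong₂ _,_ (trans (cong (λ p → lookup (proj₁ p) e) (lookup∘tabulate _ j)) (lookup∘tabulate _ e))
               (trans (cong (λ p → lookup (proj₂ p) e) (lookup∘tabulate _ j)) (lookup∘tabulate _ e)))
    (clause-cell j e)

  ∈-decomposition : ∀ {j e α} → occurrence f j e ≡ just α → e ∈ lookup (decomposition f) j ^ α
  ∈-decomposition {j} {e} {α} eq =
    ∈-cell⁺ {D = decomposition f} α (trans (cell-decomposition j e) (cong toCell eq))

  isSpecialDecomposition : IsSpecialDecomposition (decomposition f)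
  isSpecialDecomposition = record
    { disjoint = λ { j (e , e∈) → disjoint j e (x∈p∩q⁻ _ _ e∈) }
    ; inhabited = inhabited
    ; exhaustive = ⋃-allFin≡⊤ _ λ e → let j , α , j∈ = nonempty f e in
        j , ∈-^-∪ {p = lookup (decomposition f) j} α (∈-decomposition (∈-clause⁻ α j∈))
    }
    where
    disjoint : ∀ j e → ¬ (e ∈ lookup (decomposition f) j ^ false × e ∈ lookup (decomposition f) j ^ true)
    disjoint j e (e∈⁰ , e∈¹)
      with trans (sym (∈-cell⁻ {D = decomposition f} _ false (cell-decomposition j e) e∈⁰))
                 (∈-cell⁻ {D = decomposition f} _ true (cell-decomposition j e) e∈¹)
    ... | ()
    inhabited : ∀ j → Nonempty (lookup (decomposition f) j ^ false) ⊎ Nonempty (lookup (decomposition f) j ^ true)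
    inhabited j with occurs f j
    ... | e , false , j∈ = inj₁ (e , ∈-decomposition (∈-clause⁻ false j∈))
    ... | e , true  , j∈ = inj₂ (e , ∈-decomposition (∈-clause⁻ true j∈))

  generatedClauses-decomposition : generatedClauses (decomposition f) ≡ clauses f
  generatedClauses-decomposition = lookup-extensional λ e → trans (lookup∘tabulate _ e)
    (cong₂ _,_ (lookup-extensional λ j → trans (lookup∘tabulate _ j) (cong proj₁ (eq j e)))
               (lookup-extensional λ j → trans (lookup∘tabulate _ j) (cong proj₂ (eq j e))))
    where
    eq : ∀ j e → cell (decomposition f) j e ≡
                 (lookup (lookup (clauses f) e ^ false) j , lookup (lookup (clauses f) e ^ true) j)
    eq j e = trans (cell-decomposition j e) (sym (clause-cell j e))

  -- Used twice: for `f` it yields the starting special covering, for `h` the receiving pair of each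
  -- clause.
  satisfied : ∀ σ → value f σ ≡ true → ∀ e → ∃[ j ] occurrence f j e ≡ just (lookup σ j)
  satisfied σ fσ e
    with Any.satisfied (any⁻ _ (allFin n)
           (All.lookup (all⁺ _ (allFin m) (Equivalence.from Bool.T-≡ fσ)) (∈-allFin e)))
  ... | j , Tj = j , toCell-^ _ (lookup σ j)
    (trans (cong (_^ lookup σ j) (sym (clause-cell j e))) (true-literal _ (lookup σ j) Tj))

  coveredBy : ∀ σ → value f σ ≡ true → IsSpecialCovering (decomposition f) σ
  coveredBy σ fσ = ⋃-allFin≡⊤ _ λ e → let j , eq = satisfied σ fσ e in j , ∈-decomposition eq

-- The procedure

private
  variable
    p : Phase
    s : Sort
    Γ : Context

-- Superscripts in `perform`, `sM` and `setM` are syntax, not run-time values. A test therefore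
-- selects between program texts, and `P` is a function of the metalanguage.
branch : Expr p Γ → (Bool → Program p Γ) → Program p Γ
branch a P = test a == const 1ℤ then P true else P false

branchEntry : Expr p Γ → (Maybe Bool → Program p Γ) → Program p Γ
branchEntry a P =
  test a == const -1ℤ then P (just false) else test a == const 1ℤ then P (just true) else P nothing

-- When at most one component contains the element, the difference of the two bits is the entry 1,
-- -1 or 0 of the CNF matrix.
cellEntry : Index var Γ → Index clause Γ → Expr p Γ
cellEntry j e = sM true j e ⊖ sM false j e

writeCell : Index var Γ → Index clause Γ → Maybe Bool → Program build Γ
writeCell j e o = setM false j e (toCell o ^ false) ⨾ setM true j e (toCell o ^ true)

copyCell : Program build (clause ∷ var ∷ [])
copyCell = branchEntry (fcnf (here refl) (there (here refl))) (writeCell (there (here refl)) (here refl))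

copy : Program build []
copy = for var (branch σ[ here refl ] (setCurrent (here refl))) ⨾ for var (for clause copyCell)

readCell : Program readout (clause ∷ var ∷ [])
readCell = setOut (here refl) (there (here refl)) (cellEntry (there (here refl)) (here refl))

-- Leaves 0 in register 0 if there is one clause, and 1 if there are more.
compareClauseCount : Program transform []
compareClauseCount =
  setReg 0 (const 0ℤ) ⨾
  for clause (test index (here refl) == const 0ℤ then skip else setReg 0 (const 1ℤ))

flipUnless : Bool → Program transform (clause ∷ var ∷ [])
flipUnless true  = skip
flipUnless false = perform (permute (there (here refl)))

matchLiteral : Maybe Bool → Program transform (clause ∷ var ∷ [])
-- Never reached with a single clause, in which every variable occurs.
matchLiteral nothing  = skip
matchLiteral (just α) = branch (sM α (there (here refl)) (here refl)) flipUnless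

matchCell : Program transform (clause ∷ var ∷ [])
matchCell = branchEntry (hcnf (here refl) (there (here refl))) matchLiteral

alignPair : Bool → Bool → Program transform (var ∷ [])
alignPair a b = if ⌊ a Bool.≟ b ⌋ then skip else perform (permute (here refl))

alignCurrent : Bool → Program transform (var ∷ [])
alignCurrent a = branch δ[ here refl ] (alignPair a)

align : Program transform (var ∷ [])
align = branch (current (here refl)) alignCurrent

fillWith : Bool → Program transform (clause ∷ var ∷ [])
fillWith α = perform (insert (there (here refl)) α (here refl))

fillLiteral : Maybe Bool → Program transform (clause ∷ var ∷ [])
fillLiteral nothing  = branch (current (there (here refl))) fillWith
fillLiteral (just _) = skip

fillCell : Program transform (clause ∷ var ∷ [])
fillCell = branchEntry (cellEntry (there (here refl)) (here refl)) fillLiteral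

-- The literal to be replaced lies outside the covering, hence is deletable. Insertion has to come
-- second, as it is admissible only in an empty cell.
coverLiteral : Bool → Bool → Program transform (clause ∷ var ∷ [])
coverLiteral α true  = skip
coverLiteral α false =
  perform (delete (there (here refl)) (not α) (here refl)) ⨾ perform (insert (there (here refl)) α (here refl))

coverWith : Bool → Program transform (clause ∷ var ∷ [])
coverWith α = branch (sM α (there (here refl)) (here refl)) (coverLiteral α)

coverCell : Program transform (clause ∷ var ∷ [])
coverCell = branch (current (there (here refl))) coverWith

-- The context is j, i, e: the element e moves from the j-th pair to the i-th.
settleLiteral : Bool → Bool → Maybe Bool → Program transform (var ∷ var ∷ clause ∷ [])
settleLiteral α γ nothing =
  perform (move (here refl) γ (there (here refl)) α (there (there (here refl))))
settleLiteral α γ (just β) =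
  if ⌊ β Bool.≟ γ ⌋ then skip else
  (perform (move (here refl) γ (there (here refl)) α (there (there (here refl)))) ⨾
   perform (insert (here refl) β (there (there (here refl)))))

settleCovered : Bool → Bool → Bool → Program transform (var ∷ var ∷ clause ∷ [])
-- Under the invariant `IsPending`, a cell without its covering literal already agrees with `h`.
settleCovered α γ false = skip
settleCovered α γ true  = branchEntry (hcnf (there (there (here refl))) (here refl)) (settleLiteral α γ)

settleWith : Bool → Bool → Program transform (var ∷ var ∷ clause ∷ [])
settleWith α γ = branch (sM γ (here refl) (there (there (here refl)))) (settleCovered α γ)

settleCell : Bool → Program transform (var ∷ var ∷ clause ∷ [])
settleCell α = branch (current (here refl)) (settleWith α)

collect : Bool → Maybe Bool → Program transform (var ∷ clause ∷ [])
collect α nothing  = skip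
collect α (just β) = if ⌊ β Bool.≟ α ⌋ then setReg 0 (const 1ℤ) ⨾ for var (settleCell α) else skip

seekWith : Bool → Program transform (var ∷ clause ∷ [])
seekWith α = branchEntry (hcnf (there (here refl)) (here refl)) (collect α)

seek : Bool → Program transform (var ∷ clause ∷ [])
seek true  = skip
seek false = branch (current (here refl)) seekWith

-- Register 0 becomes 1 once the pair receiving the clause is found, so the inner
-- loop over the pairs runs only once for each clause.
settleClause : Program transform (clause ∷ [])
settleClause = setReg 0 (const 0ℤ) ⨾ for var (branch (reg 0) seek)

-- The argument tells whether there are at least two clauses.
convert : Bool → Program transform []
convert false = for var (for clause matchCell)
convert true  = for var align ⨾ for var (for clause fillCell) ⨾
                for var (for clause coverCell) ⨾ for clause settleClause

procedure : Procedure
procedure = record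
  { building     = copy
  ; transforming = compareClauseCount ⨾ branch (reg 0) convert
  ; readingOut   = for var (for clause readCell)
  }

-- Changing one cell

-- The effect is specified cell by cell and not by an equation between decompositions: successive
-- changes then compose by `updated-trans`, and invariants on cells carry over by `update-cell`.
record Updated (D : Decomposition n m) (j : Fin n) (e : Fin m) (c : Bool × Bool)
               (D′ : Decomposition n m) : Set where
  field
    at        : cell D′ j e ≡ c
    elsewhere : ∀ j′ e′ → ¬ (j′ ≡ j × e′ ≡ e) → cell D′ j′ e′ ≡ cell D j′ e′

open Updated

Cells : (Fin n → Fin m → Bool × Bool → Set) → Decomposition n m → Set
Cells P D = ∀ j e → P j e (cell D j e)

module _ {D D′ : Decomposition n m} {j : Fin n} {e : Fin m} {c : Bool × Bool} where

  update-cell : (P : Fin n → Fin m → Bool × Bool → Set) → Updated D j e c D′ → P j e c →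
                ∀ {j′ e′} → P j′ e′ (cell D j′ e′) → P j′ e′ (cell D′ j′ e′)
  update-cell P u Pc {j′} {e′} Pc′ with (j′ Fin.≟ j) ×-dec (e′ Fin.≟ e)
  ... | yes (refl , refl) = subst (P j e) (sym (at u)) Pc
  ... | no  other         = subst (P j′ e′) (sym (elsewhere u j′ e′ other)) Pc′

  update-cells : (P : Fin n → Fin m → Bool × Bool → Set) → Updated D j e c D′ → P j e c →
                 Cells P D → Cells P D′
  update-cells P u Pc PD j′ e′ = update-cell P u Pc (PD j′ e′)

  updated-trans : ∀ {c′ D″} → Updated D j e c D′ → Updated D′ j e c′ D″ → Updated D j e c′ D″
  updated-trans u u′ = record
    { at        = at u′
    ; elsewhere = λ j′ e′ other → trans (elsewhere u′ j′ e′ other) (elsewhere u j′ e′ other)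
    }

-- In a move, the receiving cell already contains the literal that is moved.
updated-same : ∀ {D D′ D″ : Decomposition n m} {j i e e′ c} → Updated D j e c D′ →
               ¬ (i ≡ j × e′ ≡ e) → Updated D′ i e′ (cell D i e′) D″ → Updated D j e c D″
updated-same {D = D} {D′} {D″} {j} {i} {e} {e′} u other u′ = record
  { at        = trans (elsewhere u′ j e λ { (refl , refl) → other (refl , refl) }) (at u)
  ; elsewhere = λ j″ e″ → update-cell (λ j″ e″ c″ → ¬ (j″ ≡ j × e″ ≡ e) → c″ ≡ cell D j″ e″)
                            u′ (λ _ → refl) (elsewhere u j″ e″)
  }

updated-refl : {D : Decomposition n m} {j : Fin n} {e : Fin m} {c : Bool × Bool} →
               cell D j e ≡ c → Updated D j e c D
updated-refl eq = record { at = eq ; elsewhere = λ _ _ _ → refl }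

module _ (D : Decomposition n m) (j : Fin n) {e : Fin m} {b : Bool} (g : Subset m → Subset m)
         (g≡ : ∀ p → g p ≡ p [ e ]≔ b) where

  updateAt-updated : ∀ α → Updated D j e (updateComponent α (λ _ → b) (cell D j e))
                                   (updateAt D j (updateComponent α g))
  updateAt-updated α = record
    { at        = trans (cong cellAt (lookup∘updateAt j D)) (cell-same α (lookup D j))
    ; elsewhere = elsewhere′
    }
    where
    cellAt : Subset _ × Subset _ → Bool × Bool
    cellAt r = lookup (r ^ false) e , lookup (r ^ true) e
    same : ∀ p → lookup (g p) e ≡ b
    same p = trans (cong (λ q → lookup q e) (g≡ p)) (lookup∘updateAt e p)
    other : ∀ {e′} p → e′ ≢ e → lookup (g p) e′ ≡ lookup p e′
    other {e′} p e′≢e = trans (cong (λ q → lookup q e′) (g≡ p)) (lookup∘updateAt′ e′ e e′≢e p)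
    cell-same : ∀ α r → cellAt (updateComponent α g r) ≡ updateComponent α (λ _ → b) (cellAt r)
    cell-same false (p⁰ , p¹) = cong (_, lookup p¹ e) (same p⁰)
    cell-same true  (p⁰ , p¹) = cong (lookup p⁰ e ,_) (same p¹)
    cell-other : ∀ α r {e′} → e′ ≢ e →
      (lookup (updateComponent α g r ^ false) e′ , lookup (updateComponent α g r ^ true) e′)
      ≡ (lookup (r ^ false) e′ , lookup (r ^ true) e′)
    cell-other false (p⁰ , p¹) {e′} e′≢e = cong (_, lookup p¹ e′) (other p⁰ e′≢e)
    cell-other true  (p⁰ , p¹) {e′} e′≢e = cong (lookup p⁰ e′ ,_) (other p¹ e′≢e)
    elsewhere′ : ∀ j′ e′ → ¬ (j′ ≡ j × e′ ≡ e) → cell (updateAt D j (updateComponent α g)) j′ e′ ≡ cell D j′ e′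
    elsewhere′ j′ e′ ne with j′ Fin.≟ j
    ... | yes refl = trans (cong (λ r → lookup (r ^ false) e′ , lookup (r ^ true) e′) (lookup∘updateAt j D))
                           (cell-other α (lookup D j) (λ e′≡e → ne (refl , e′≡e)))
    ... | no  j′≢j = cong (λ r → lookup (r ^ false) e′ , lookup (r ^ true) e′) (lookup∘updateAt′ j′ j j′≢j D)

updated-as : {D D′ : Decomposition n m} {j : Fin n} {e : Fin m} {c c′ : Bool × Bool} →
             c ≡ c′ → Updated D j e c D′ → Updated D j e c′ D′
updated-as refl u = u

updateComponent-insert : ∀ α → updateComponent α (λ _ → true) (toCell nothing) ≡ toCell (just α)
updateComponent-insert false = refl
updateComponent-insert true  = refl

updateComponent-delete : ∀ α → updateComponent α (λ _ → false) (toCell (just α)) ≡ toCell nothing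
updateComponent-delete false = refl
updateComponent-delete true  = refl

updateComponent-reinsert : ∀ α → updateComponent α (λ _ → true) (toCell (just α)) ≡ toCell (just α)
updateComponent-reinsert false = refl
updateComponent-reinsert true  = refl

cell-permute : ∀ (D : Decomposition n m) j e → cell (updateAt D j swap) j e ≡ swap (cell D j e)
cell-permute D j e = cong (λ r → lookup (r ^ false) e , lookup (r ^ true) e) (lookup∘updateAt j D)

cell-permute-other : ∀ (D : Decomposition n m) {j j′} e → j′ ≢ j → cell (updateAt D j swap) j′ e ≡ cell D j′ e
cell-permute-other D {j} {j′} e j′≢j =
  cong (λ r → lookup (r ^ false) e , lookup (r ^ true) e) (lookup∘updateAt′ j′ j j′≢j D)

-- Program logic with operation counts

-- One iteration of an amortised loop: the drop of the potential from `Φ` to `Φ′` pays for the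
-- excess of `b` over the budget `B`, and 3 is the overhead of the loop itself.
loop-step : ∀ {Φ Φ′ Φ″ k l b B r} → k ≤ b → Φ′ + b ≤ Φ + B → Φ″ + l ≤ Φ′ + r →
            Φ″ + (1 + k + 2 + l) ≤ Φ + (3 + B + r)
loop-step {Φ} {Φ′} {Φ″} {k} {l} {b} {B} {r} k≤b paid rest = begin
  Φ″ + (1 + k + 2 + l)
    ≡⟨ solve 3 (λ x y z → x :+ (con 1 :+ y :+ con 2 :+ z) := (x :+ z) :+ (con 3 :+ y)) refl Φ″ k l ⟩
  (Φ″ + l) + (3 + k)     ≤⟨ ℕ.+-mono-≤ rest (ℕ.+-monoʳ-≤ 3 k≤b) ⟩
  (Φ′ + r) + (3 + b)     ≡⟨ solve 3 (λ x y z → (x :+ y) :+ (con 3 :+ z) := (x :+ z) :+ (con 3 :+ y)) refl Φ′ r b ⟩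
  (Φ′ + b) + (3 + r)     ≤⟨ ℕ.+-monoˡ-≤ (3 + r) paid ⟩
  (Φ + B) + (3 + r)      ≡⟨ solve 3 (λ x y z → (x :+ y) :+ (con 3 :+ z) := x :+ (con 3 :+ y :+ z)) refl Φ B r ⟩
  Φ + (3 + B + r)        ∎
  where
  open ℕ.≤-Reasoning
  open +-*-Solver

module Correctness {n m : ℕ} (f h : CNF n m) (σ δ : Vec Bool n) where

  open Execution f h σ δ

  private
    variable
      ρ : Environment Γ
      M M′ : Memory n m
      k B B′ : ℕ
      Q R : Memory n m → Set

  mutual
    -- In the phase `transform` only `perform` alters the configuration, and its rule carries
    -- admissibility. So the chain of changes is read off from any execution.
    run-changes : {c : Program transform Γ} → Run ρ c M M′ k → configuration M ⟶* configuration M′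
    run-changes skip            = ε
    run-changes (seq r r′)      = run-changes r ◅◅ run-changes r′
    run-changes assign          = ε
    run-changes (if-true _ r)   = run-changes r
    run-changes (if-false _ r)  = run-changes r
    run-changes (for rs)        = runEach-changes rs
    run-changes (perform adm)   = change _ adm ◅ ε

    runEach-changes : {c : Program transform (s ∷ Γ)} {xs : List (Fin (size s))} →
                      RunEach ρ c xs M M′ k → configuration M ⟶* configuration M′
    runEach-changes []       = ε
    runEach-changes (r ∷ rs) = run-changes r ◅◅ runEach-changes rs

  -- A total-correctness triple with a cost bound, which contains the execution itself. The initial
  -- memory is fixed, so preconditions are ordinary hypotheses on `M`.
  record Triple (ρ : Environment Γ) (c : Program p Γ) (M : Memory n m) (B : ℕ)
                (Q : Memory n m → Set) : Set where
    constructor triple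
    field
      {final} : Memory n m
      {cost}  : ℕ
      run     : Run ρ c M final cost
      cost≤   : cost ≤ B
      post    : Q final

  conseq : {c : Program p Γ} → B ≤ B′ → (∀ {M′} → Q M′ → R M′) → Triple ρ c M B Q → Triple ρ c M B′ R
  conseq B≤B′ Q⇒R (triple r k≤B q) = triple r (ℕ.≤-trans k≤B B≤B′) (Q⇒R q)

  skip-triple : Q M → Triple ρ (skip {p = p}) M B Q
  skip-triple q = triple skip z≤n q

  seq-triple : {c d : Program p Γ} → Triple ρ c M B Q → (∀ {M′} → Q M′ → Triple ρ d M′ B′ R) →
               Triple ρ (c ⨾ d) M (B + B′) R
  seq-triple (triple r k≤B q) t with t q
  ... | triple r′ l≤B′ q′ = triple (seq r r′) (ℕ.+-mono-≤ k≤B l≤B′) q′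

  branch-triple : ∀ (a : Expr p Γ) P b → ⟦ a ⟧ ρ M ≡ bit b → Triple ρ (P b) M B Q →
                  Triple ρ (branch a P) M (testCost (a == const 1ℤ) + B) Q
  branch-triple _ _ true  eq (triple r k≤B q) =
    triple (if-true (cong (λ z → ⌊ z ℤ.≟ 1ℤ ⌋) eq) r) (ℕ.+-monoʳ-≤ _ k≤B) q
  branch-triple _ _ false eq (triple r k≤B q) =
    triple (if-false (cong (λ z → ⌊ z ℤ.≟ 1ℤ ⌋) eq) r) (ℕ.+-monoʳ-≤ _ k≤B) q

  branchEntry-triple : ∀ (a : Expr p Γ) P o → ⟦ a ⟧ ρ M ≡ toℤ o → Triple ρ (P o) M B Q →
    Triple ρ (branchEntry a P) M (testCost (a == const 1ℤ) + (testCost (a == const 1ℤ) + B)) Q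
  branchEntry-triple a _ (just false) eq (triple r k≤B q) =
    triple (if-true (cong (λ z → ⌊ z ℤ.≟ -1ℤ ⌋) eq) r)
           (ℕ.+-monoʳ-≤ (testCost (a == const 1ℤ)) (ℕ.≤-trans k≤B (ℕ.m≤n+m _ _))) q
  branchEntry-triple a _ (just true)  eq (triple r k≤B q) =
    triple (if-false (cong (λ z → ⌊ z ℤ.≟ -1ℤ ⌋) eq) (if-true (cong (λ z → ⌊ z ℤ.≟ 1ℤ ⌋) eq) r))
           (ℕ.+-monoʳ-≤ (testCost (a == const 1ℤ)) (ℕ.+-monoʳ-≤ (testCost (a == const 1ℤ)) k≤B)) q
  branchEntry-triple a _ nothing      eq (triple r k≤B q) =
    triple (if-false (cong (λ z → ⌊ z ℤ.≟ -1ℤ ⌋) eq) (if-false (cong (λ z → ⌊ z ℤ.≟ 1ℤ ⌋) eq) r))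
           (ℕ.+-monoʳ-≤ (testCost (a == const 1ℤ)) (ℕ.+-monoʳ-≤ (testCost (a == const 1ℤ)) k≤B)) q

  -- Preservation of every `Done y` spares the invariant from recording which indices have been
  -- visited.
  Progress : {X : Set} → (Memory n m → Set) → (X → Memory n m → Set) → X → Memory n m → Memory n m → Set
  Progress I Done x M M′ = I M′ × Done x M′ × (∀ {y} → Done y M → Done y M′)

  module _ {c : Program p (s ∷ Γ)} (I : Memory n m → Set) (Done : Fin (size s) → Memory n m → Set) where

    -- Φ is a potential paying for the iterations that cost more than B.
    forEach-amortised : (Φ : Memory n m → ℕ) →
      (∀ x {M} → I M → ∃[ b ] Triple (x ∷ ρ) c M b (λ M′ → Φ M′ + b ≤ Φ M + B × Progress I Done x M M′)) →
      I M → Triple ρ (for s c) M (Φ M + (2 + size s * (3 + B))) (λ M′ → I M′ × ∀ x → Done x M′)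
    forEach-amortised {ρ = ρ} {B} {M} Φ body i with each (allFin (size s)) i
      where
      each : ∀ xs {M} → I M → ∃[ M′ ] ∃[ k ] RunEach ρ c xs M M′ k ×
             Φ M′ + k ≤ Φ M + (1 + length xs * (3 + B)) ×
             I M′ × (∀ {x} → x List.∈ xs → Done x M′) × (∀ {y} → Done y M → Done y M′)
      each []       i = _ , _ , [] , ℕ.≤-refl , i , (λ ()) , id
      each (x ∷ xs) {M} i with body x i
      ... | b , triple {M₁} r k≤b (paid , i₁ , done , keep) with each xs i₁
      ... | M₂ , l , rs , rest , i₂ , dones , keeps =
        M₂ , _ , r ∷ rs ,
        ℕ.≤-trans (loop-step {Φ M} {Φ M₁} {Φ M₂} k≤b paid rest)
          (ℕ.≤-reflexive (cong (Φ M +_) (ℕ.+-suc (3 + B) (length xs * (3 + B))))) ,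
        i₂ , (λ { (here refl) → keeps done ; (there x∈) → dones x∈ }) , keeps ∘ keep
    ... | M′ , k , rs , k≤ , i′ , dones , _ = triple (for rs) bound (i′ , λ x → dones (∈-allFin x))
      where
      open ℕ.≤-Reasoning
      -- The final potential is dropped. Of the 2, one is the initial assignment to the loop
      -- variable and one the last test.
      bound : 1 + k ≤ Φ M + (2 + size s * (3 + B))
      bound = begin
        1 + k                                                 ≤⟨ ℕ.+-monoʳ-≤ 1 (ℕ.m≤n+m k (Φ M′)) ⟩
        1 + (Φ M′ + k)                                        ≤⟨ ℕ.+-monoʳ-≤ 1 k≤ ⟩
        1 + (Φ M + (1 + length (allFin (size s)) * (3 + B)))  ≡⟨ ℕ.+-suc (Φ M) _ ⟨
        Φ M + (2 + length (allFin (size s)) * (3 + B))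
          ≡⟨ cong (λ l → Φ M + (2 + l * (3 + B))) (List.length-tabulate {n = size s} id) ⟩
        Φ M + (2 + size s * (3 + B))                          ∎

    forEach : (∀ x {M} → I M → Triple (x ∷ ρ) c M B (Progress I Done x M)) →
      I M → Triple ρ (for s c) M (2 + size s * (3 + B)) (λ M′ → I M′ × ∀ x → Done x M′)
    forEach body = forEach-amortised (λ _ → 0)
      (λ x i → _ , conseq ℕ.≤-refl (ℕ.≤-refl ,_) (body x i))

  module _ {c : Program p (clause ∷ var ∷ Γ)} (I : Memory n m → Set) (Done : Fin n → Fin m → Memory n m → Set) where

    forCells :
      (∀ j e {M} → I M → Triple (e ∷ j ∷ ρ) c M B
        (λ M′ → I M′ × Done j e M′ × (∀ {j′ e′} → Done j′ e′ M → Done j′ e′ M′))) →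
      I M → Triple ρ (for var (for clause c)) M (2 + n * (3 + (2 + m * (3 + B))))
                   (λ M′ → I M′ × ∀ j e → Done j e M′)
    forCells body = forEach I (λ j M → ∀ e → Done j e M) λ j {M} i →
      conseq ℕ.≤-refl (λ { ((i′ , keep) , done) → i′ , done , λ d e → keep (d e) })
        -- The inner invariant refers back to the memory `M` at the start of the inner loop, so that
        -- preservation of all finished cells is available to the outer loop.
        (forEach (λ M′ → I M′ × (∀ {j′ e′} → Done j′ e′ M → Done j′ e′ M′)) (Done j)
          (λ { e (i′ , keep) → conseq ℕ.≤-refl
             (λ { (i″ , done , keep′) → (i″ , λ d → keep′ (keep d)) , done , keep′ }) (body j e i′) })
          (i , id))

  -- Writing one cell: loops over the table and single changes

  record Writes (M : Memory n m) (j : Fin n) (e : Fin m) (c : Bool × Bool) (M′ : Memory n m) : Set where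
    field
      cells      : Updated (sMatrices M) j e c (sMatrices M′)
      tuple≡     : tuple M′ ≡ tuple M
      registers≡ : registers M′ ≡ registers M

  open Writes

  writes-refl : ∀ {j e c} → cell (sMatrices M) j e ≡ c → Writes M j e c M
  writes-refl eq = record { cells = updated-refl eq ; tuple≡ = refl ; registers≡ = refl }

  writes-trans : ∀ {M″ j e c c′} → Writes M j e c M′ → Writes M′ j e c′ M″ → Writes M j e c′ M″
  writes-trans w w′ = record
    { cells      = updated-trans (cells w) (cells w′)
    ; tuple≡     = trans (tuple≡ w′) (tuple≡ w)
    ; registers≡ = trans (registers≡ w′) (registers≡ w)
    }

  -- `A` is what a body may assume of all cells, `G` what it achieves in its own. As it writes only
  -- that cell, with a value satisfying both, neither is lost elsewhere.
  forCells-writes : {c : Program p (clause ∷ var ∷ Γ)} (τ : Vec Bool n)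
    (A G : Fin n → Fin m → Bool × Bool → Set) →
    (∀ j e {M} → tuple M ≡ τ → Cells A (sMatrices M) →
      Triple (e ∷ j ∷ ρ) c M B (λ M′ → ∃[ x ] (Writes M j e x M′ × A j e x × G j e x))) →
    tuple M ≡ τ → Cells A (sMatrices M) →
    Triple ρ (for var (for clause c)) M (2 + n * (3 + (2 + m * (3 + B))))
           (λ M′ → tuple M′ ≡ τ × Cells G (sMatrices M′))
  forCells-writes τ A G body M-τ M-A = conseq ℕ.≤-refl (λ { ((t , _) , g) → t , g })
    (forCells (λ M → tuple M ≡ τ × Cells A (sMatrices M)) (λ j e M → G j e (cell (sMatrices M) j e))
      (λ { j e (t , a) → conseq ℕ.≤-refl
             (λ { (x , w , Ax , Gx) →
                  (trans (tuple≡ w) t , update-cells A (cells w) Ax a) ,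
                  subst (G j e) (sym (at (cells w))) Gx , update-cell G (cells w) Gx })
             (body j e t a) })
      (M-τ , M-A))

  module _ {ρ : Environment Γ} {M : Memory n m} (jx : Index var Γ) (ex : Index clause Γ) where

    private
      j = All.lookup ρ jx
      e = All.lookup ρ ex
      D = sMatrices M

    cellEntry-value : ∀ {o} → cell D j e ≡ toCell o → ⟦ cellEntry {p = p} jx ex ⟧ ρ M ≡ toℤ o
    cellEntry-value {o = o} eq = trans (cong (λ c → bit (proj₂ c) ℤ.- bit (proj₁ c)) eq) (value-toCell o)
      where
      value-toCell : ∀ o → bit (proj₂ (toCell o)) ℤ.- bit (proj₁ (toCell o)) ≡ toℤ o
      value-toCell nothing      = refl
      value-toCell (just false) = refl
      value-toCell (just true)  = refl

    sM-value : ∀ {c} α → cell D j e ≡ c → ⟦ sM {p = p} α jx ex ⟧ ρ M ≡ bit (c ^ α)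
    sM-value α eq = cong bit (trans (lookup-cell D j e α) (cong (_^ α) eq))

    insert-triple : ∀ α → cell D j e ≡ toCell nothing →
                    Triple ρ (perform (insert jx α ex)) M 1 (Writes M j e (toCell (just α)))
    insert-triple α eq = triple (perform (λ e∈ → absent (x∈p∪q⁻ _ _ e∈))) ℕ.≤-refl
      (record { cells = updated-as (trans (cong (updateComponent α _) eq) (updateComponent-insert α))
                          (updateAt-updated D j _ (λ p → p∪⁅x⁆≡p[x]≔true p e) α)
              ; tuple≡ = refl ; registers≡ = refl })
      where
      absent : ¬ (e ∈ lookup D j ^ false ⊎ e ∈ lookup D j ^ true)
      absent (inj₁ e∈) with () ← ∈-cell⁻ {D = D} nothing false eq e∈
      absent (inj₂ e∈) with () ← ∈-cell⁻ {D = D} nothing true eq e∈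

    -- The occupied cell at `e′` witnesses that the pair stays inhabited, whichever component
    -- contains `e′`.
    delete-triple : ∀ α → cell D j e ≡ toCell (just α) → α ≢ lookup (tuple M) j →
                    (∃[ e′ ] e′ ≢ e × ∃[ β ] cell D j e′ ≡ toCell (just β)) →
                    Triple ρ (perform (delete jx α ex)) M 1 (Writes M j e (toCell nothing))
    delete-triple α eq α≢ (e′ , e′≢e , β , eq′) =
      triple (perform (∈-cell⁺ {D = D} α eq , α≢ , e′ , e′∈ α β eq′)) ℕ.≤-refl
      (record { cells = updated-as (trans (cong (updateComponent α _) eq) (updateComponent-delete α))
                          (updateAt-updated D j _ (λ p → p-x≡p[x]≔false p e) α)
              ; tuple≡ = refl ; registers≡ = refl })
      where
      kept : ∀ {p} → e′ ∈ p → e′ ∈ p - e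
      kept {p} e′∈ = x∈p∧x≢y⇒x∈p-y e′∈ e′≢e
      e′∈ : ∀ α β → cell D j e′ ≡ toCell (just β) → e′ ∈ (lookup D j ^ α - e) ∪ lookup D j ^ not α
      e′∈ false false eq′ = x∈p∪q⁺ (inj₁ (kept (∈-cell⁺ {D = D} false eq′)))
      e′∈ false true  eq′ = x∈p∪q⁺ (inj₂ (∈-cell⁺ {D = D} true eq′))
      e′∈ true  false eq′ = x∈p∪q⁺ (inj₂ (∈-cell⁺ {D = D} false eq′))
      e′∈ true  true  eq′ = x∈p∪q⁺ (inj₁ (kept (∈-cell⁺ {D = D} true eq′)))

    -- The receiving set already contains `e`, so the net effect is to empty the sender's cell. This
    -- replaces the forbidden deletion of a covering literal.
    move-triple : ∀ ix {γ α} → j ≢ All.lookup ρ ix →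
      γ ≡ lookup (tuple M) j → α ≡ lookup (tuple M) (All.lookup ρ ix) →
      cell D j e ≡ toCell (just γ) → cell D (All.lookup ρ ix) e ≡ toCell (just α) →
      Triple ρ (perform (move jx γ ix α ex)) M 2 (Writes M j e (toCell nothing))
    move-triple ix {γ} {α} j≢i γ≡ α≡ eqʲ eqⁱ =
      triple (perform (j≢i , γ≡ , α≡ , ∈-cell⁺ {D = D} γ eqʲ , absent α eqⁱ)) ℕ.≤-refl
        (record { cells = updated-same removed (j≢i ∘ sym ∘ proj₁)
                    (updated-as added (updateAt-updated D₁ i _ (λ p → p∪⁅x⁆≡p[x]≔true p e) α))
                ; tuple≡ = refl ; registers≡ = refl })
      where
      i  = All.lookup ρ ix
      D₁ = updateAt D j (updateComponent γ (_- e))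
      removed : Updated D j e (toCell nothing) D₁
      removed = updated-as (trans (cong (updateComponent γ _) eqʲ) (updateComponent-delete γ))
                  (updateAt-updated D j _ (λ p → p-x≡p[x]≔false p e) γ)
      added : updateComponent α (λ _ → true) (cell D₁ i e) ≡ cell D i e
      added = trans (cong (updateComponent α _) (trans (elsewhere removed i e (j≢i ∘ sym ∘ proj₁)) eqⁱ))
                    (trans (updateComponent-reinsert α) (sym eqⁱ))
      absent : ∀ α → cell D i e ≡ toCell (just α) → e ∉ lookup D i ^ not α
      absent false eq e∈ with () ← ∈-cell⁻ {D = D} (just false) true eq e∈
      absent true  eq e∈ with () ← ∈-cell⁻ {D = D} (just true) false eq e∈

    writeCell-triple : ∀ o → Triple ρ (writeCell jx ex o) M 2 (Writes M j e (toCell o))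
    writeCell-triple o = triple (seq assignM assignM) ℕ.≤-refl
      (record { cells = updated-as (cong (updateComponent true _) (at first)) (updated-trans first second)
              ; tuple≡ = refl ; registers≡ = refl })
      where
      first  = updateAt-updated D j {e} {toCell o ^ false} (_[ e ]≔ toCell o ^ false) (λ _ → refl) false
      second = updateAt-updated (updateAt D j (updateComponent false (_[ e ]≔ toCell o ^ false)))
                 j {e} {toCell o ^ true} (_[ e ]≔ toCell o ^ true) (λ _ → refl) true

  -- Counting clauses, copying `f` and reading out `h`

  count-triple : Triple [] compareClauseCount M (1 + (2 + m * (3 + 2)))
    (λ M′ → configuration M′ ≡ configuration M
          × (registers M′ 0 ≡ 0ℤ ⊎ registers M′ 0 ≡ 1ℤ × ∃[ e ] toℕ {m} e ≢ 0)
          × ∀ e → toℕ {m} e ≡ 0 ⊎ registers M′ 0 ≡ 1ℤ)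
  count-triple {M = M} = seq-triple {Q = Inv}
    (triple assign ℕ.≤-refl (refl , inj₁ refl))
    λ inv → conseq ℕ.≤-refl (λ { ((config≡ , r) , done) → config≡ , r , done }) (forEach Inv Done compare inv)
    where
    -- `Inv` decides the case of one clause, where no index is nonzero; `Done` at index 1 decides
    -- the case of several.
    Inv : Memory n m → Set
    Inv M′ = configuration M′ ≡ configuration M
           × (registers M′ 0 ≡ 0ℤ ⊎ registers M′ 0 ≡ 1ℤ × ∃[ e ] toℕ {m} e ≢ 0)
    Done : Fin m → Memory n m → Set
    Done e M′ = toℕ e ≡ 0 ⊎ registers M′ 0 ≡ 1ℤ
    compare : ∀ e {M} → Inv M →
      Triple (e ∷ []) (test index (here refl) == const 0ℤ then skip else setReg 0 (const 1ℤ)) M 2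
             (Progress Inv Done e M)
    compare e inv with toℕ e in eq
    ... | zero  = triple (if-true (cong (λ k → ⌊ ℤ.+ k ℤ.≟ 0ℤ ⌋) eq) skip) (toWitness {a? = 1 ℕ.≤? 2} tt)
                    (inv , inj₁ refl , id)
    ... | suc _ = triple (if-false (cong (λ k → ⌊ ℤ.+ k ℤ.≟ 0ℤ ⌋) eq) assign) ℕ.≤-refl
                    ((proj₁ inv , inj₂ (refl , e , λ e≡0 → contradiction (trans (sym eq) e≡0) λ ())) ,
                     inj₂ refl , λ _ → inj₂ refl)

  -- The predicates follow the stages in turn. `IsPending` allows each cell to be as before or as
  -- desired, so the last stage keeps no record of the clauses already settled.
  IsOccurrence IsLiteral IsCovering IsPending IsSolved : Fin n → Fin m → Bool × Bool → Set
  IsOccurrence j e c = ∃[ o ] c ≡ toCell o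
  IsLiteral    j e c = ∃[ α ] c ≡ toCell (just α)
  IsCovering   j e c = c ≡ toCell (just (lookup δ j))
  IsSolved     j e c = c ≡ toCell (occurrence h j e)
  IsPending    j e c = IsCovering j e c ⊎ IsSolved j e c

  solved-decomposition : {D : Decomposition n m} → Cells IsSolved D → D ≡ decomposition h
  solved-decomposition solved =
    decomposition-extensional λ j e → trans (solved j e) (sym (cell-decomposition h j e))

  copy-triple : Triple [] copy M ((2 + n * 5) + (2 + n * (3 + (2 + m * 7))))
                       (λ M′ → configuration M′ ≡ (decomposition f , σ))
  copy-triple {M = M} = seq-triple
    (forEach (λ _ → ⊤′) (λ j M → lookup (tuple M) j ≡ lookup σ j)
      (λ j {M} _ → branch-triple σ[ here refl ] (setCurrent (here refl)) (lookup σ j) refl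
        (triple assignτ ℕ.≤-refl
          (tt , lookup∘update j (tuple M) _ , λ {y} → keep j y {M})))
      tt)
    λ { (_ , t) → conseq ℕ.≤-refl
      (λ { (t′ , c) → cong₂ _,_
             (decomposition-extensional λ j e → trans (c j e) (sym (cell-decomposition f j e))) t′ })
      (forCells-writes σ (λ _ _ _ → ⊤′) (λ j e c → c ≡ toCell (occurrence f j e))
        (λ j e _ _ → branchEntry-triple
          (fcnf (here refl) (there (here refl))) (writeCell (there (here refl)) (here refl))
          (occurrence f j e) (lookup-cnfMatrix f j e)
          (conseq ℕ.≤-refl (λ w → _ , w , tt , refl)
            (writeCell-triple (there (here refl)) (here refl) (occurrence f j e))))
        (lookup-extensional t) (λ _ _ → tt)) }
    where
    keep : ∀ j y {M} → lookup (tuple M) y ≡ lookup σ y → lookup (tuple M [ j ]≔ lookup σ j) y ≡ lookup σ y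
    keep j y {M} eq with y Fin.≟ j
    ... | yes refl = lookup∘update j (tuple M) _
    ... | no  y≢j  = trans (lookup∘update′ y≢j (tuple M) _) eq

  readOut-triple : sMatrices M ≡ decomposition h →
    Triple [] (readingOut procedure) M (2 + n * (3 + (2 + m * 5))) (λ M′ → output M′ ≡ cnfMatrix h)
  readOut-triple D≡ = conseq ℕ.≤-refl
    (λ { (_ , out) → lookup-extensional λ e → lookup-extensional λ j →
           trans (out j e) (sym (lookup-cnfMatrix h j e)) })
    (forCells (λ M → sMatrices M ≡ decomposition h) Written
      (λ j e {M} D≡ → triple assignO ℕ.≤-refl (D≡ ,
         trans (written j e {M}) (value-h j e {M} D≡) ,
         λ {j′} {e′} → keep j e {M} (value-h j e {M} D≡) j′ e′))
      D≡)
    where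
    Written : Fin n → Fin m → Memory n m → Set
    Written j e M = lookup (lookup (output M) e) j ≡ toℤ (occurrence h j e)
    value-h : ∀ j e {M} → sMatrices M ≡ decomposition h →
      ⟦ cellEntry {p = readout} (there (here refl)) (here refl) ⟧ (e ∷ j ∷ []) M ≡ toℤ (occurrence h j e)
    value-h j e {M} D≡ = cellEntry-value {ρ = e ∷ j ∷ []} {M} (there (here refl)) (here refl) {p = readout}
      (trans (cong (λ D → cell D j e) D≡) (cell-decomposition h j e))
    written : ∀ j e {M z} → lookup (lookup (output (storeOutput e j z M)) e) j ≡ z
    written j e {M} {z} = trans (cong (λ r → lookup r j) (lookup∘updateAt e (output M)))
                            (lookup∘update j (lookup (output M) e) z)
    keep : ∀ j e {M z} → z ≡ toℤ (occurrence h j e) → ∀ j′ e′ → Written j′ e′ M → Written j′ e′ (storeOutput e j z M)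
    keep j e {M} {z} z≡ j′ e′ w with e′ Fin.≟ e
    ... | no e′≢e = trans (cong (λ r → lookup r j′) (lookup∘updateAt′ e′ e e′≢e (output M))) w
    ... | yes refl with j′ Fin.≟ j
    ...   | yes refl = trans (written j e {M}) z≡
    ...   | no j′≢j  = trans (cong (λ r → lookup r j′) (lookup∘updateAt e (output M)))
                             (trans (lookup∘update′ j′≢j (lookup (output M) e) z) w)

  -- Aligning the tuple, filling and covering

  permute-occurrences : ∀ j {D : Decomposition n m} → Cells IsOccurrence D →
                        Cells IsOccurrence (updateAt D j swap)
  permute-occurrences j {D} occ j′ e with j′ Fin.≟ j
  ... | yes refl = let o , eq = occ j e in
                   Maybe.map not o , trans (cell-permute D j e) (trans (cong swap eq) (swap-toCell o))
  ... | no j′≢j  = let o , eq = occ j′ e in o , trans (cell-permute-other D e j′≢j) eq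

  -- A wrong superscript is corrected by one flip, so the row swap, linear in `m`, happens at most
  -- once per pair.
  align-triple : Cells IsOccurrence (sMatrices M) →
    Triple [] (for var align) M (2 + n * (3 + (2 + (m * 6 + 2 + 2))))
           (λ M′ → tuple M′ ≡ δ × Cells IsOccurrence (sMatrices M′))
  align-triple occ = conseq ℕ.≤-refl (λ { (occ , t) → lookup-extensional t , occ })
    (forEach (λ M → Cells IsOccurrence (sMatrices M)) Aligned
      (λ j {M} occ → branch-triple (current (here refl)) alignCurrent (lookup (tuple M) j) refl
        (branch-triple δ[ here refl ] (alignPair (lookup (tuple M) j)) (lookup δ j) refl (alignPair-triple j occ)))
      occ)
    where
    Aligned : Fin n → Memory n m → Set
    Aligned j M = lookup (tuple M) j ≡ lookup δ j
    alignPair-triple : ∀ j {M} → Cells IsOccurrence (sMatrices M) →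
      Triple (j ∷ []) (alignPair (lookup (tuple M) j) (lookup δ j)) M (m * 6 + 2 + 2)
             (Progress (λ M → Cells IsOccurrence (sMatrices M)) Aligned j M)
    alignPair-triple j {M} occ with lookup (tuple M) j Bool.≟ lookup δ j
    ... | yes eq = skip-triple (occ , eq , id)
    ... | no  ne = triple (perform tt) ℕ.≤-refl (permute-occurrences j {sMatrices M} occ , flipped , λ {y} → keep y)
      where
      flipped : lookup (updateAt (tuple M) j not) j ≡ lookup δ j
      flipped = trans (lookup∘updateAt j (tuple M)) (sym (Bool.¬-not (ne ∘ sym)))
      keep : ∀ y → lookup (tuple M) y ≡ lookup δ y → lookup (updateAt (tuple M) j not) y ≡ lookup δ y
      keep y eq with y Fin.≟ j
      ... | yes refl = flipped
      ... | no y≢j   = trans (lookup∘updateAt′ y j y≢j (tuple M)) eq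

  fill-triple : tuple M ≡ δ → Cells IsOccurrence (sMatrices M) →
    Triple [] (for var (for clause fillCell)) M (2 + n * (3 + (2 + m * (3 + 6))))
           (λ M′ → tuple M′ ≡ δ × Cells IsLiteral (sMatrices M′))
  fill-triple = forCells-writes δ IsOccurrence IsLiteral λ j e {M} _ occ →
    let o , eq = occ j e in
    branchEntry-triple (cellEntry (there (here refl)) (here refl)) fillLiteral o
      (cellEntry-value {ρ = e ∷ j ∷ []} {M} (there (here refl)) (here refl) {p = transform} eq)
      (fillLiteral-triple o eq)
    where
    fillLiteral-triple : ∀ {j e M} o → cell (sMatrices M) j e ≡ toCell o →
      Triple (e ∷ j ∷ []) (fillLiteral o) M 2
             (λ M′ → ∃[ c ] (Writes M j e c M′ × IsOccurrence j e c × IsLiteral j e c))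
    fillLiteral-triple {j} {e} {M} nothing eq =
      branch-triple (current (there (here refl))) fillWith (lookup (tuple M) j) refl
        (conseq ℕ.≤-refl (λ w → _ , w , (_ , refl) , (_ , refl))
          (insert-triple (there (here refl)) (here refl) (lookup (tuple M) j) eq))
    fillLiteral-triple (just α) eq = skip-triple (_ , writes-refl eq , (_ , refl) , (_ , refl))

  -- The second clause given by `another` supplies an occupied cell in the same row. The table
  -- remains full because each deletion is followed by an insertion into the same cell.
  cover-triple : (∀ (e : Fin m) → ∃[ e′ ] e′ ≢ e) → tuple M ≡ δ → Cells IsLiteral (sMatrices M) →
    Triple [] (for var (for clause coverCell)) M (2 + n * (3 + (2 + m * (3 + 4))))
           (λ M′ → tuple M′ ≡ δ × Cells IsCovering (sMatrices M′))
  cover-triple another = forCells-writes δ IsLiteral IsCovering λ j e {M} t lit →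
    let α = lookup (tuple M) j ; β , eq = lit j e in
    branch-triple (current (there (here refl))) coverWith α refl
      (branch-triple (sM α (there (here refl)) (here refl)) (coverLiteral α) (toCell (just β) ^ α)
        (sM-value {ρ = e ∷ j ∷ []} {M} (there (here refl)) (here refl) {p = transform} α eq)
        (conseq ℕ.≤-refl
          (λ w → _ , subst (λ τ → Writes M j e (toCell (just (lookup τ j))) _) t w , (_ , refl) , refl)
          (coverLiteral-triple eq lit)))
    where
    coverLiteral-triple : ∀ {j e M β} → cell (sMatrices M) j e ≡ toCell (just β) → Cells IsLiteral (sMatrices M) →
      let α = lookup (tuple M) j in
      Triple (e ∷ j ∷ []) (coverLiteral α (toCell (just β) ^ α)) M 2 (Writes M j e (toCell (just α)))
    coverLiteral-triple {j} {e} {M} {β} eq lit with toCell (just β) ^ lookup (tuple M) j in covered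
    ... | true  = skip-triple (writes-refl (trans eq (cong toCell (toCell-^ (just β) _ covered))))
    ... | false = seq-triple
      (delete-triple (there (here refl)) (here refl) (not α)
        (trans eq (cong (toCell ∘ just) (Bool.¬-not β≢α))) (Bool.not-¬ refl ∘ sym)
        (let e′ , e′≢e = another e in e′ , e′≢e , lit j e′))
      λ w → conseq ℕ.≤-refl (writes-trans w)
        (insert-triple (there (here refl)) (here refl) α (at (cells w)))
      where
      α = lookup (tuple M) j
      β≢α : β ≢ α
      β≢α refl with () ← trans (sym covered) (toCell-just-^ β)

  -- Settling the clauses of `h`

  module _ (hδ : value h δ ≡ true) where

    settleLiteral-triple : ∀ {j i e M α γ} o → γ ≡ lookup (tuple M) j → α ≡ lookup (tuple M) i →
      cell (sMatrices M) j e ≡ toCell (just γ) → cell (sMatrices M) i e ≡ toCell (just α) →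
      (o ≢ just γ → j ≢ i) →
      Triple (j ∷ i ∷ e ∷ []) (settleLiteral α γ o) M 3 (Writes M j e (toCell o))
    settleLiteral-triple nothing γ≡ α≡ eqʲ eqⁱ apart =
      conseq (toWitness {a? = 2 ℕ.≤? 3} tt) id
        (move-triple (here refl) (there (there (here refl))) (there (here refl)) (apart λ ()) γ≡ α≡ eqʲ eqⁱ)
    settleLiteral-triple {γ = γ} (just β) γ≡ α≡ eqʲ eqⁱ apart with β Bool.≟ γ
    ... | yes refl = skip-triple (writes-refl eqʲ)
    ... | no  β≢γ  = seq-triple
      (move-triple (here refl) (there (there (here refl))) (there (here refl))
        (apart λ { refl → β≢γ refl }) γ≡ α≡ eqʲ eqⁱ)
      λ w → conseq ℕ.≤-refl (writes-trans w)
        (insert-triple (here refl) (there (there (here refl))) β (at (cells w)))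

    settleCell-triple : ∀ {j i e M} → tuple M ≡ δ → Cells IsPending (sMatrices M) →
      occurrence h i e ≡ just (lookup δ i) →
      Triple (j ∷ i ∷ e ∷ []) (settleCell (lookup δ i)) M 7 (Writes M j e (toCell (occurrence h j e)))
    settleCell-triple {j} {i} {e} {M} τ≡δ pending found =
      branch-triple (current (here refl)) (settleWith (lookup δ i)) γ refl (settleWith-triple (pending j e))
      where
      D = sMatrices M
      γ = lookup (tuple M) j
      o = occurrence h j e
      -- Settling does not alter the receiver's cell, where `h` has the covering literal; so both
      -- cases of `IsPending` agree.
      eqⁱ : cell D i e ≡ toCell (just (lookup δ i))
      eqⁱ with pending i e
      ... | inj₁ eq = eq
      ... | inj₂ eq = trans eq (cong toCell found)
      -- In the receiver's own cell the entry of `h` is the covering literal, so a move is called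
      -- for only from a different pair.
      apart : o ≢ just γ → j ≢ i
      apart o≢ refl = o≢ (trans found (cong (λ τ → just (lookup τ j)) (sym τ≡δ)))
      sM-γ : ∀ {c} → cell D j e ≡ c →
             ⟦ sM {p = transform} γ (here refl) (there (there (here refl))) ⟧ (j ∷ i ∷ e ∷ []) M ≡ bit (c ^ γ)
      sM-γ = sM-value {ρ = j ∷ i ∷ e ∷ []} {M} (here refl) (there (there (here refl))) {p = transform} γ
      covered : cell D j e ≡ toCell (just γ) →
                Triple (j ∷ i ∷ e ∷ []) (settleWith (lookup δ i) γ) M 6 (Writes M j e (toCell o))
      covered eqʲ = branch-triple (sM γ (here refl) (there (there (here refl)))) (settleCovered (lookup δ i) γ) true
        (trans (sM-γ eqʲ) (cong bit (toCell-just-^ γ)))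
        (branchEntry-triple (hcnf (there (there (here refl))) (here refl)) (settleLiteral (lookup δ i) γ) o
          (lookup-cnfMatrix h j e)
          (settleLiteral-triple o refl (cong (λ τ → lookup τ i) (sym τ≡δ)) eqʲ eqⁱ apart))
      settleWith-triple : IsPending j e (cell D j e) →
                Triple (j ∷ i ∷ e ∷ []) (settleWith (lookup δ i) γ) M 6 (Writes M j e (toCell o))
      settleWith-triple (inj₁ eq) = covered (trans eq (cong (λ τ → toCell (just (lookup τ j))) (sym τ≡δ)))
      settleWith-triple (inj₂ eq) with toCell o ^ γ in covers
      ... | true  = covered (trans eq (cong toCell (toCell-^ o γ covers)))
      ... | false = branch-triple (sM γ (here refl) (there (there (here refl)))) (settleCovered (lookup δ i) γ) false
        (trans (sM-γ eq) (cong bit covers)) (skip-triple (writes-refl eq))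

    -- The last conjunct, relative to `M₀`, is the preservation of finished clauses that the loop
    -- over clauses asks for.
    Settling : Memory n m → Memory n m → Set
    Settling M₀ M = tuple M ≡ δ × Cells IsPending (sMatrices M) ×
                    (∀ {j e} → IsSolved j e (cell (sMatrices M₀) j e) → IsSolved j e (cell (sMatrices M) j e))

    collectCost : ℕ
    collectCost = 2 + n * (3 + 7)

    collect-triple : ∀ {M₀ M} i e → Settling M₀ M → registers M 0 ≡ 1ℤ → occurrence h i e ≡ just (lookup δ i) →
      Triple (i ∷ e ∷ []) (for var (settleCell (lookup δ i))) M collectCost
        (λ M′ → (Settling M₀ M′ × registers M′ 0 ≡ 1ℤ) × ∀ j → IsSolved j e (cell (sMatrices M′) j e))
    collect-triple {M₀} i e settling r≡1 found =
      forEach (λ M → Settling M₀ M × registers M 0 ≡ 1ℤ) (λ j M → IsSolved j e (cell (sMatrices M) j e))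
        (λ { j {M} ((τ≡δ , pending , kept) , r≡1) → conseq ℕ.≤-refl
          (λ w → ((trans (tuple≡ w) τ≡δ , update-cells IsPending (cells w) (inj₂ refl) pending ,
                   λ {j′} {e′} solved → update-cell IsSolved (cells w) refl (kept {j′} {e′} solved)) ,
                  trans (cong (λ r → r 0) (registers≡ w)) r≡1) ,
                 at (cells w) , λ {j′} → update-cell IsSolved (cells w) refl {j′} {e})
          (settleCell-triple {i = i} τ≡δ pending found) })
        (settling , r≡1)

    settleClause-triple : ∀ {M} e → tuple M ≡ δ → Cells IsPending (sMatrices M) →
      Triple (e ∷ []) settleClause M (1 + (collectCost + (2 + n * (3 + 5))))
        (λ M′ → Settling M M′ × ∀ j → IsSolved j e (cell (sMatrices M′) j e))
    settleClause-triple {M₀} e τ≡δ pending = seq-triple {Q = _≡ storeRegister 0 0ℤ M₀}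
      (triple assign ℕ.≤-refl refl)
      λ { refl → conseq ℕ.≤-refl (λ {M} → finish {M})
        (forEach-amortised Inv Found unspent (λ i {M} → seek-triple i {M}) ((τ≡δ , pending , id) , inj₁ refl)) }
      where
      Inv : Memory n m → Set
      Inv M = Settling M₀ M × (registers M 0 ≡ 0ℤ ⊎ registers M 0 ≡ 1ℤ × ∀ j → IsSolved j e (cell (sMatrices M) j e))
      -- Being conditional, this holds trivially at pairs that cannot receive. At the end
      -- `satisfied` provides a pair for which the premise is true.
      Found : Fin n → Memory n m → Set
      Found i M = occurrence h i e ≡ just (lookup δ i) → registers M 0 ≡ 1ℤ
      -- The potential is the cost of the one pass over the pairs, available until register 0 is
      -- set.
      unspent : Memory n m → ℕ
      unspent M = if ⌊ registers M 0 ℤ.≟ 1ℤ ⌋ then 0 else collectCost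
      finish : ∀ {M} → Inv M × (∀ i → Found i M) → Settling M₀ M × ∀ j → IsSolved j e (cell (sMatrices M) j e)
      finish ((settling , inj₂ (_ , solved)) , _) = settling , solved
      finish ((settling , inj₁ r≡0) , found) with satisfied h δ hδ e
      ... | i , eq with () ← trans (sym r≡0) (found i eq)
      unspent≡0 : ∀ {M} → registers M 0 ≡ 1ℤ → unspent M ≡ 0
      unspent≡0 r≡1 = cong (λ z → if ⌊ z ℤ.≟ 1ℤ ⌋ then 0 else collectCost) r≡1
      unspent≡collectCost : ∀ {M} → registers M 0 ≡ 0ℤ → unspent M ≡ collectCost
      unspent≡collectCost r≡0 = cong (λ z → if ⌊ z ℤ.≟ 1ℤ ⌋ then 0 else collectCost) r≡0
      seek-triple : ∀ i {M} → Inv M → ∃[ b ] Triple (i ∷ e ∷ []) (branch (reg 0) seek) M b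
        (λ M′ → unspent M′ + b ≤ unspent M + 5 × Progress Inv Found i M M′)
      seek-triple i {M} inv@(_ , inj₂ (r≡1 , _)) = 1 , branch-triple (reg 0) seek true r≡1
        (skip-triple (ℕ.+-monoʳ-≤ (unspent M) (toWitness {a? = 1 ℕ.≤? 5} tt) , inv , (λ _ → r≡1) , id))
      seek-triple i {M} inv@(settling@(τ≡δ , pending , kept) , inj₁ r≡0) =
        -- The 4 counts one comparison for the register, one for the superscript and two for the
        -- entry of `h`. The budget 5 also covers setting the register.
        let b , t = select (occurrence h i e) refl in
        4 + b , branch-triple (reg 0) seek false r≡0
          (branch-triple (current (here refl)) seekWith (lookup δ i) (cong (λ τ → bit (lookup τ i)) τ≡δ)
            (branchEntry-triple (hcnf (there (here refl)) (here refl)) (collect (lookup δ i)) (occurrence h i e)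
              (lookup-cnfMatrix h i e) t))
        where
        skipped : occurrence h i e ≢ just (lookup δ i) →
          Triple (i ∷ e ∷ []) (skip {p = transform}) M 0
            (λ M′ → unspent M′ + 4 ≤ unspent M + 5 × Progress Inv Found i M M′)
        skipped none = skip-triple
          (ℕ.+-monoʳ-≤ (unspent M) (toWitness {a? = 4 ℕ.≤? 5} tt) , inv , (λ found → contradiction found none) , id)
        select : ∀ o → occurrence h i e ≡ o → ∃[ b ] Triple (i ∷ e ∷ []) (collect (lookup δ i) o) M b
          (λ M′ → unspent M′ + (4 + b) ≤ unspent M + 5 × Progress Inv Found i M M′)
        select nothing eq = 0 , skipped λ found → contradiction (trans (sym eq) found) λ ()
        select (just β) eq with β Bool.≟ lookup δ i
        ... | no  β≢  = 0 , skipped λ found → contradiction (trans (sym eq) found) λ { refl → β≢ refl }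
        ... | yes refl = 1 + collectCost , seq-triple {Q = _≡ storeRegister 0 1ℤ M}
          (triple assign ℕ.≤-refl refl)
          λ { refl → conseq ℕ.≤-refl
            (λ { {M′} ((settling′ , r≡1) , solved) →
                 ℕ.≤-reflexive (trans (cong (_+ (5 + collectCost)) (unspent≡0 {M′} r≡1))
                   (trans (ℕ.+-comm 5 collectCost) (cong (_+ 5) (sym (unspent≡collectCost {M} r≡0))))) ,
                 (settling′ , inj₂ (r≡1 , solved)) , (λ _ → r≡1) , λ _ _ → r≡1 })
            (collect-triple {M₀} i e settling refl eq) }

    convert-triple : (∀ (e : Fin m) → ∃[ e′ ] e′ ≢ e) → Cells IsOccurrence (sMatrices M) →
      Triple [] (convert true) M
        ((2 + n * (3 + (2 + (m * 6 + 2 + 2)))) + ((2 + n * (3 + (2 + m * 9))) +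
         ((2 + n * (3 + (2 + m * 7))) + (2 + m * (3 + (1 + (collectCost + (2 + n * 8))))))))
        (λ M′ → sMatrices M′ ≡ decomposition h)
    convert-triple another occ =
      seq-triple (align-triple occ) λ { (τ≡δ , occ) →
      seq-triple (fill-triple τ≡δ occ) λ { (τ≡δ , lit) →
      seq-triple (cover-triple another τ≡δ lit) λ { (τ≡δ , covered) →
      conseq ℕ.≤-refl (λ { (_ , solved) → solved-decomposition λ j e → solved e j })
        (forEach (λ M → tuple M ≡ δ × Cells IsPending (sMatrices M))
          (λ e M → ∀ j → IsSolved j e (cell (sMatrices M) j e))
          (λ { e (τ≡δ , pending) → conseq ℕ.≤-refl
             (λ { ((τ≡δ , pending , kept) , solved) →
                  (τ≡δ , pending) , solved , λ {e′} done j → kept {j} {e′} (done j) })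
             (settleClause-triple e τ≡δ pending) })
          (τ≡δ , λ j e → inj₁ (covered j e))) }}}

-- A single clause

module OneClause {n : ℕ} (f h : CNF n 1) (σ δ : Vec Bool n) where

  open Execution f h σ δ
  open Correctness f h σ δ

  private
    variable
      M : Memory n 1

  -- `occurs` has only one clause to name.
  cells-literal : (g : CNF n 1) → ∀ j e → ∃[ α ] occurrence g j e ≡ just α
  cells-literal g j zero with occurs g j
  ... | zero , α , j∈ = α , ∈-clause⁻ g α j∈

  -- A row consists of a single cell here, so a permutation can be treated as a write to that cell.
  permute-updated : ∀ {D : Decomposition n 1} {j e α β} → cell D j e ≡ toCell (just β) → β ≢ α →
                    Updated D j e (toCell (just α)) (updateAt D j swap)
  permute-updated {D} {j} {zero} {α} {β} eq β≢α = record
    { at        = trans (cell-permute D j zero) (trans (cong swap eq)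
                    (trans (swap-toCell (just β)) (cong (toCell ∘ just) (sym (Bool.¬-not (β≢α ∘ sym))))))
    ; elsewhere = λ { j′ zero other → cell-permute-other D zero λ j′≡j → other (j′≡j , refl) }
    }

  convert-triple₁ : Cells IsLiteral (sMatrices M) →
    Triple [] (convert false) M (2 + n * (3 + (2 + 1 * (3 + 13)))) (λ M′ → sMatrices M′ ≡ decomposition h)
  convert-triple₁ lit = conseq ℕ.≤-refl (λ { (_ , solved) → solved-decomposition solved })
    (forCells Inv Solved
      (λ j e {M} lit → branchEntry-triple (hcnf (here refl) (there (here refl))) matchLiteral
        (occurrence h j e) (lookup-cnfMatrix h j e) (matchLiteral-triple j e (occurrence h j e) refl lit))
      lit)
    where
    Inv : Memory n 1 → Set
    Inv M = Cells IsLiteral (sMatrices M)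
    Solved : Fin n → Fin 1 → Memory n 1 → Set
    Solved j e M = IsSolved j e (cell (sMatrices M) j e)
    Post : Fin n → Fin 1 → Memory n 1 → Memory n 1 → Set
    Post j e M M′ = Inv M′ × Solved j e M′ × (∀ {j′ e′} → Solved j′ e′ M → Solved j′ e′ M′)
    flipUnless-triple : ∀ j e {M α β} → Inv M → occurrence h j e ≡ just α → cell (sMatrices M) j e ≡ toCell (just β) →
      Triple (e ∷ j ∷ []) (flipUnless (toCell (just β) ^ α)) M 10 (Post j e M)
    flipUnless-triple j e {M} {α} {β} lit hα eq with toCell (just β) ^ α in same
    ... | true  = skip-triple (lit , trans eq (cong toCell (trans (toCell-^ (just β) α same) (sym hα))) , id)
    ... | false = triple (perform tt) ℕ.≤-refl
      (update-cells IsLiteral u (α , refl) lit , trans (at u) (cong toCell (sym hα)) ,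
       λ {j′} {e′} → update-cell IsSolved u (cong toCell (sym hα)) {j′} {e′})
      where
      u : Updated (sMatrices M) j e (toCell (just α)) (updateAt (sMatrices M) j swap)
      u = permute-updated {sMatrices M} {j} {e} eq
            λ { refl → contradiction (trans (sym (toCell-just-^ β)) same) λ () }
    matchLiteral-triple : ∀ j e {M} o → occurrence h j e ≡ o → Inv M →
      Triple (e ∷ j ∷ []) (matchLiteral o) M 11 (Post j e M)
    matchLiteral-triple j e nothing  hα lit =
      contradiction (trans (sym hα) (proj₂ (cells-literal h j e))) λ ()
    matchLiteral-triple j e {M} (just α) hα lit = let β , eq = lit j e in
      branch-triple (sM α (there (here refl)) (here refl)) flipUnless (toCell (just β) ^ α)
        (sM-value {ρ = e ∷ j ∷ []} {M} (there (here refl)) (here refl) {p = transform} α eq)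
        (flipUnless-triple j e lit hα eq)

-- Bounds

-- For nonzero `n` and `m`, each of 1, `n` and `m` is at most `n * m`.
bilinear-bound : ∀ n m .{{_ : NonZero n}} .{{_ : NonZero m}} a b c d →
  a + b * n + c * m + d * (n * m) ≤ (a + b + c + d) * (n * m)
bilinear-bound n m a b c d = begin
  a + b * n + c * m + d * (n * m)
    ≤⟨ ℕ.+-monoˡ-≤ (d * N) (ℕ.+-mono-≤ (ℕ.+-mono-≤ (ℕ.m≤m*n a N) (ℕ.*-monoʳ-≤ b (ℕ.m≤m*n n m)))
                                        (ℕ.*-monoʳ-≤ c (ℕ.m≤n*m m n))) ⟩
  a * N + b * N + c * N + d * N
    ≡⟨ solve 5 (λ a b c d N → a :* N :+ b :* N :+ c :* N :+ d :* N := (a :+ b :+ c :+ d) :* N) refl a b c d N ⟩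
  (a + b + c + d) * N ∎
  where
  open ℕ.≤-Reasoning
  open +-*-Solver
  N = n * m
  instance
    N≢0 : NonZero N
    N≢0 = ℕ.m*n≢0 n m

copy-bound : ∀ n m .{{_ : NonZero n}} .{{_ : NonZero m}} →
  (2 + n * 5) + (2 + n * (3 + (2 + m * 7))) ≤ 21 * (n * m)
copy-bound n m = ℕ.≤-trans (ℕ.≤-reflexive (solve 2 (λ n m →
  (con 2 :+ n :* con 5) :+ (con 2 :+ n :* (con 3 :+ (con 2 :+ m :* con 7))) :=
  con 4 :+ con 10 :* n :+ con 0 :* m :+ con 7 :* (n :* m)) refl n m)) (bilinear-bound n m 4 10 0 7)
  where open +-*-Solver

readOut-bound : ∀ n m .{{_ : NonZero n}} .{{_ : NonZero m}} → 2 + n * (3 + (2 + m * 5)) ≤ 12 * (n * m)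
readOut-bound n m = ℕ.≤-trans (ℕ.≤-reflexive (solve 2 (λ n m →
  con 2 :+ n :* (con 3 :+ (con 2 :+ m :* con 5)) :=
  con 2 :+ con 5 :* n :+ con 0 :* m :+ con 5 :* (n :* m)) refl n m)) (bilinear-bound n m 2 5 0 5)
  where open +-*-Solver

convert₁-bound : ∀ n .{{_ : NonZero n}} →
  (1 + (2 + 1 * 5)) + (1 + (2 + n * (3 + (2 + 1 * (3 + 13))))) ≤ 84 * (n * 1)
convert₁-bound n = ℕ.≤-trans (ℕ.≤-reflexive (solve 1 (λ n →
  con 8 :+ (con 1 :+ (con 2 :+ n :* con 21)) :=
  con 11 :+ con 21 :* n :+ con 0 :* con 1 :+ con 0 :* (n :* con 1)) refl n))
  -- The sum 32 is relaxed to 84, the constant for several clauses, so that both cases share one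
  -- bound.
  (ℕ.≤-trans (bilinear-bound n 1 11 21 0 0) (ℕ.*-monoˡ-≤ (n * 1) (toWitness {a? = 32 ℕ.≤? 84} tt)))
  where open +-*-Solver

convert-bound : ∀ n m .{{_ : NonZero n}} .{{_ : NonZero m}} →
  (1 + (2 + m * 5)) + (1 +
    ((2 + n * (3 + (2 + (m * 6 + 2 + 2)))) + ((2 + n * (3 + (2 + m * 9))) +
     ((2 + n * (3 + (2 + m * 7))) + (2 + m * (3 + (1 + ((2 + n * 10) + (2 + n * 8)))))))))
  ≤ 84 * (n * m)
convert-bound n m = ℕ.≤-trans (ℕ.≤-reflexive (solve 2 (λ n m →
  (con 1 :+ (con 2 :+ m :* con 5)) :+ (con 1 :+
    ((con 2 :+ n :* (con 3 :+ (con 2 :+ (m :* con 6 :+ con 2 :+ con 2)))) :+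
     ((con 2 :+ n :* (con 3 :+ (con 2 :+ m :* con 9))) :+
      ((con 2 :+ n :* (con 3 :+ (con 2 :+ m :* con 7))) :+
       (con 2 :+ m :* (con 3 :+ (con 1 :+ ((con 2 :+ n :* con 10) :+ (con 2 :+ n :* con 8))))))))) :=
  con 12 :+ con 19 :* n :+ con 13 :* m :+ con 40 :* (n :* m)) refl n m)) (bilinear-bound n m 12 19 13 40)
  where open +-*-Solver

-- Assembling the phases

another : (e : Fin (suc (suc m))) → ∃[ e′ ] e′ ≢ e
another zero    = suc zero , λ ()
another (suc _) = zero , λ ()

transforming-triple : ∀ {n} m .{{_ : NonZero n}} .{{_ : NonZero m}} (f h : CNF n m) (σ δ : Vec Bool n) →
  let open Execution f h σ δ ; open Correctness f h σ δ in
  value h δ ≡ true → ∀ {M} → sMatrices M ≡ decomposition f →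
  Triple [] (transforming procedure) M (84 * (n * m)) (λ M′ → sMatrices M′ ≡ decomposition h)
transforming-triple zero f h σ δ hδ D≡ = contradiction refl (≢-nonZero⁻¹ 0)
transforming-triple {n} 1 f h σ δ hδ {M} D≡ =
  conseq (convert₁-bound n) id (seq-triple count-triple λ { {M′} (config≡ , r , _) →
    branch-triple (reg 0) convert false (absent r) (convert-triple₁ (literals {M′} config≡)) })
  where
  open Correctness f h σ δ
  open OneClause f h σ δ
  absent : ∀ {z} → z ≡ 0ℤ ⊎ z ≡ 1ℤ × ∃[ e ] toℕ {1} e ≢ 0 → z ≡ 0ℤ
  absent (inj₁ r≡0)            = r≡0
  absent (inj₂ (_ , zero , e≢0)) = contradiction refl e≢0
  literals : ∀ {M′} → configuration M′ ≡ configuration M → Cells IsLiteral (sMatrices M′)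
  literals config≡ j e = let α , eq = cells-literal f j e in
    α , trans (cong (λ D → cell D j e) (trans (cong proj₁ config≡) D≡))
              (trans (cell-decomposition f j e) (cong toCell eq))
transforming-triple {n} (suc (suc m)) f h σ δ hδ {M} D≡ =
  conseq (convert-bound n (suc (suc m))) id (seq-triple count-triple λ { {M′} (config≡ , _ , done) →
    branch-triple (reg 0) convert true (several (done (suc zero)))
      (convert-triple hδ another λ j e →
        occurrence f j e ,
        trans (cong (λ D → cell D j e) (trans (cong proj₁ config≡) D≡)) (cell-decomposition f j e)) })
  where
  open Correctness f h σ δ
  several : ∀ {z} → 1 ≡ 0 ⊎ z ≡ 1ℤ → z ≡ 1ℤ
  several (inj₂ r≡1) = r≡1

theorem6p7 : Σ[ P ∈ Procedure ] Σ[ c ∈ ℕ ] ∀ (n m : ℕ) .{{_ : NonZero m}} (f h : CNF n m) (σ δ : Vec Bool n) →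
    value f σ ≡ true → value h δ ≡ true →
    ∀ (M₀ : Memory n m) → GeneratesWithin P f h σ δ M₀ (c * (n * m))
-- 117 = 21 + 84 + 12, for building, transforming and reading out.
theorem6p7 = procedure , 117 , generates
  where
  generates : ∀ (n m : ℕ) .{{_ : NonZero m}} (f h : CNF n m) (σ δ : Vec Bool n) →
    value f σ ≡ true → value h δ ≡ true →
    ∀ (M₀ : Memory n m) → GeneratesWithin procedure f h σ δ M₀ (117 * (n * m))
  generates n m f h σ δ fσ hδ M₀ = record
    { runBuilding     = run building-triple
    ; start           = post building-triple
    ; startCovering   = coveredBy f σ fσ
    ; runTransforming = run changing-triple
    ; changes         = subst (_⟶* configuration (final changing-triple)) (post building-triple)
                          (run-changes (run changing-triple))
    ; isDecomposition = subst IsSpecialDecomposition (sym (post changing-triple)) (isSpecialDecomposition h)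
    ; generated       = trans (cong generatedClauses (post changing-triple)) (generatedClauses-decomposition h)
    ; runReadingOut   = run reading-triple
    ; result          = post reading-triple
    ; withinBound     = ℕ.≤-trans
        (ℕ.+-mono-≤ (ℕ.+-mono-≤ (ℕ.≤-trans (cost≤ building-triple) (copy-bound n m)) (cost≤ changing-triple))
                    (ℕ.≤-trans (cost≤ reading-triple) (readOut-bound n m)))
        (ℕ.≤-reflexive (sym (trans (ℕ.*-distribʳ-+ (n * m) (21 + 84) 12)
                                   (cong (_+ 12 * (n * m)) (ℕ.*-distribʳ-+ (n * m) 21 84)))))
    }
    where
    open Correctness f h σ δ
    open Triple
    -- As `m` is nonzero there is a first clause, and a literal of it names a variable.
    instance
      n≢0 : NonZero n
      n≢0 = Fin.nonZeroIndex (proj₁ (nonempty f (fromℕ< (>-nonZero⁻¹ m))))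
    building-triple = copy-triple {M = M₀}
    changing-triple = transforming-triple m f h σ δ hδ (cong proj₁ (post building-triple))
    reading-triple  = readOut-triple (post changing-triple)
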